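{- There is an absolute constant $c>0$ such that for every $n\ge 1$, every function $f:\{0,1\}^n\to\{0,1\}$, every integer $k\ge 2$, and every $0\le\varepsilon\le\frac1{20}$, \[ \overline{\mathrm{R}}_\varepsilon(f^k) \ge c\cdot k\cdot \overline{\mathrm{R}}_{\varepsilon/k}(f). \]
   Context: For $f:\{0,1\}^n\to\{0,1\}$ and $k\ge 2$, $f^k:\{0,1\}^{nk}\to\{0,1\}^k$ is defined by $f^k(x^{(1)},\dots,x^{(k)})=(f(x^{(1)}),\dots,f(x^{(k)}))$. A randomized query algorithm adaptively queries input bits (using internal randomness) and outputs a value; it computes a function $g$ with error $\varepsilon$ if on every input $x$ it outputs exactly $g(x)$ with probability at least $1-\varepsilon$. $\overline{\mathrm{R}}_\varepsilon(g)$ is the minimum, over algorithms computing $g$ with error at most $\varepsilon$, of the maximum over inputs $x$ of the expected number of queries made on $x$.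
   Formalization: The error ε is a rational number in [0, 1/20], and a randomized query algorithm is a finitely supported distribution with rational probabilities over deterministic decision trees; the English allows real ε and real probabilities. -}

module Defs where

open import Data.Bool using (Bool; true; false; if_then_else_)
open import Data.Nat as ℕ using (ℕ; zero; suc)
open import Data.Integer using (+_)
open import Data.Rational using (ℚ; 0ℚ; 1ℚ; _+_; _*_; _/_; _≤_)
open import Data.Fin using (Fin)
open import Data.Vec using (Vec; tabulate)
open import Data.Vec.Properties using (≡-dec)
open import Data.List using (List; []; _∷_)
open import Data.List.Relation.Unary.All using (All)
open import Data.Product using (_×_; _,_; proj₁; ∃)
open import Relation.Binary.PropositionalEquality using (_≡_)
open import Relation.Binary.Definitions using (DecidableEquality)
open import Relation.Nullary.Decidable using (⌊_⌋)
import Data.Bool as B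

data DTree (I : Set) (O : Set) : Set where
  leaf : O → DTree I O
  node : I → DTree I O → DTree I O → DTree I O

eval : {I O : Set} → DTree I O → (I → Bool) → O
eval (leaf o) x = o
eval (node i t₀ t₁) x = if x i then eval t₁ x else eval t₀ x

queries : {I O : Set} → DTree I O → (I → Bool) → ℕ
queries (leaf o) x = 0
queries (node i t₀ t₁) x = suc (if x i then queries t₁ x else queries t₀ x)

-- A randomized query algorithm: a finite probability distribution over
-- deterministic decision trees (weights with the trees they select).
RAlg : Set → Set → Set
RAlg I O = List (ℚ × DTree I O)

totalWeight : {I O : Set} → RAlg I O → ℚ
totalWeight [] = 0ℚ
totalWeight ((w , t) ∷ A) = w + totalWeight A

IsDistribution : {I O : Set} → RAlg I O → Set
IsDistribution A = All (λ p → 0ℚ ≤ proj₁ p) A × totalWeight A ≡ 1ℚ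

toℚ : ℕ → ℚ
toℚ m = + m / 1

expQueries : {I O : Set} → RAlg I O → (I → Bool) → ℚ
expQueries [] x = 0ℚ
expQueries ((w , t) ∷ A) x = w * toℚ (queries t x) + expQueries A x

errProb : {I O : Set} → DecidableEquality O → RAlg I O → (I → Bool) → O → ℚ
errProb _≟_ [] x v = 0ℚ
errProb _≟_ ((w , t) ∷ A) x v =
  (if ⌊ eval t x ≟ v ⌋ then 0ℚ else w) + errProb _≟_ A x v

Computes : {I O : Set} → DecidableEquality O → RAlg I O → ((I → Bool) → O) → ℚ → Set
Computes _≟_ A g ε = IsDistribution A × (∀ x → errProb _≟_ A x (g x) ≤ ε)

-- r ≤ \overline{R}_ε(g):  every algorithm computing g with error ≤ ε has
-- worst-case (max over inputs) expected query count at least r.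
LowerBoundR : {I O : Set} → DecidableEquality O → ((I → Bool) → O) → ℚ → ℚ → Set
LowerBoundR {I} {O} _≟_ g ε r =
  (A : RAlg I O) → Computes _≟_ A g ε → ∃ λ (x : I → Bool) → r ≤ expQueries A x

BoolFun : ℕ → Set
BoolFun n = (Fin n → Bool) → Bool

directSum : {n : ℕ} → BoolFun n → (k : ℕ) → (Fin k × Fin n → Bool) → Vec Bool k
directSum f k x = tabulate (λ i → f (λ j → x (i , j)))

LowerBoundRf : {n : ℕ} → BoolFun n → ℚ → ℚ → Set
LowerBoundRf f = LowerBoundR B._≟_ f

LowerBoundRfk : {n : ℕ} → BoolFun n → (k : ℕ) → ℚ → ℚ → Set
LowerBoundRfk f k = LowerBoundR (≡-dec B._≟_) (directSum f k)

-- ε / k  (k ≥ 2; the proof only serves to make k nonzero)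
divBy : ℚ → (k : ℕ) → 2 ℕ.≤ k → ℚ
divBy ε (suc m) _ = ε * (+ 1 / suc m)

{-# OPTIONS --safe #-}

-- Let A compute f^k with error ε and cost q. Given any distribution μ on inputs of f, plant an
-- input y at a uniformly random coordinate i of A, draw the other coordinates from μ, and abort
-- when an output before coordinate i is wrong. On average over y ∼ μ the expected number of
-- queries to y is at most q / k; a run aborts only if A errs, so with probability at most ε; and
-- since only the first wrong output of A counts, the probability of a wrong answer is at most
-- ε / k. A minimax theorem, proved by Fourier–Motzkin elimination over ℚ, turns this into one
-- algorithm meeting all three bounds, up to a factor 3, on every input. Running that algorithm
-- twice and accepting only equal answers makes the error O((ε / k)²); a run fails with
-- probability at most 1/2, and it is then repeated. After sufficiently many failures the whole
-- input is read, which adds an arbitrarily small amount to the expected cost.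
module Submission where

open import Defs
open import Data.Bool as Bool using (Bool; true; false; if_then_else_)
open import Data.Fin as Fin using (Fin; zero; suc)
open import Data.Fin.Patterns using (0F; 1F; 2F)
import Data.Integer as ℤ
import Data.Integer.Properties as ℤ
open import Data.List as List using (List; []; _∷_; _++_; map; filter; cartesianProductWith)
open import Data.List.Membership.Propositional using (_∈_; lose)
open import Data.List.Membership.Propositional.Properties using (∈-filter⁺; ∈-filter⁻; ∈-++⁺ˡ; ∈-++⁺ʳ; ∈-++⁻; ∈-cartesianProductWith⁺; ∈-cartesianProductWith⁻; ∈-map⁺; ∈-map⁻; ∈-allFin)
open import Data.List.Relation.Unary.All as All using (All; []; _∷_)
open import Data.List.Relation.Unary.All.Properties using (++⁺; map⁺)
open import Data.List.Relation.Unary.Any using (here; there; any?; satisfied)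
open import Data.Maybe using (Maybe; just; nothing)
open import Data.Nat as ℕ using (ℕ; zero; suc; _≤_)
open import Data.Nat.Coprimality using (1-coprimeTo) renaming (sym to coprime-sym)
open import Data.Product using (Σ; _×_; _,_; proj₁; proj₂; ∃; map₂)
open import Data.Rational using (ℚ; mkℚ; *≤*; ½; 0ℚ; 1ℚ; _<_; _+_; _*_; _-_; -_; _/_; 1/_; _⊓_; positive; nonNegative) renaming (_≤_ to _≤ℚ_)
open import Data.Rational.Properties
open import Data.Rational.Solver using (module +-*-Solver)
open import Data.Sum as Sum using (_⊎_; inj₁; inj₂)
open import Data.Vec as Vec using (Vec; []; _∷_; lookup; tabulate; _[_]≔_)
open import Data.Vec.Properties using (≡-dec; lookup∘update; lookup∘update′; map-[]≔; tabulate∘lookup; tabulate-∘; lookup∘tabulate)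
open import Function using (_∘_; id)
open import Relation.Binary.Definitions using (tri<; tri≈; tri>; DecidableEquality)
open import Relation.Binary.PropositionalEquality using (_≡_; _≗_; refl; sym; trans; cong; cong₂; subst; module ≡-Reasoning)
open import Relation.Nullary using (¬_; yes; no; ¬?; contradiction)
open import Relation.Nullary.Decidable using (⌊_⌋)
open +-*-Solver using (Polynomial; solve; con; _:=_; _:+_; _:*_; _:-_; :-_)

-- Ordered-field facts

0≤-+ : ∀ {p q} → 0ℚ ≤ℚ p → 0ℚ ≤ℚ q → 0ℚ ≤ℚ p + q
0≤-+ p q = ≤-trans (≤-reflexive (sym (+-identityˡ 0ℚ))) (+-mono-≤ p q)

0<-+ˡ : ∀ {p q} → 0ℚ < p → 0ℚ ≤ℚ q → 0ℚ < p + q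
0<-+ˡ p q = ≤-<-trans (≤-reflexive (sym (+-identityˡ 0ℚ))) (+-mono-<-≤ p q)

0<-+ʳ : ∀ {p q} → 0ℚ ≤ℚ p → 0ℚ < q → 0ℚ < p + q
0<-+ʳ p q = ≤-<-trans (≤-reflexive (sym (+-identityˡ 0ℚ))) (+-mono-≤-< p q)

0≤-* : ∀ {p q} → 0ℚ ≤ℚ p → 0ℚ ≤ℚ q → 0ℚ ≤ℚ p * q
0≤-* {p} {q} hp hq =
  subst (_≤ℚ p * q) (*-zeroʳ p) (*-monoˡ-≤-nonNeg p {{nonNegative hp}} hq)

0<-* : ∀ {p q} → 0ℚ < p → 0ℚ < q → 0ℚ < p * q
0<-* {p} {q} hp hq =
  subst (_< p * q) (*-zeroʳ p) (*-monoʳ-<-pos p {{positive hp}} hq)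

*-monoˡ : ∀ {r p q} → 0ℚ ≤ℚ r → p ≤ℚ q → r * p ≤ℚ r * q
*-monoˡ {r} hr = *-monoˡ-≤-nonNeg r {{nonNegative hr}}

*-monoʳ : ∀ {r p q} → 0ℚ ≤ℚ r → p ≤ℚ q → p * r ≤ℚ q * r
*-monoʳ {r} hr = *-monoʳ-≤-nonNeg r {{nonNegative hr}}

≤⇒0≤- : ∀ {p q} → p ≤ℚ q → 0ℚ ≤ℚ q - p
≤⇒0≤- {p} {q} h = subst (_≤ℚ q - p) (+-inverseʳ p) (+-monoˡ-≤ (- p) h)

0≤-⇒≤ : ∀ {p q} → 0ℚ ≤ℚ q - p → p ≤ℚ q
0≤-⇒≤ {p} {q} h = subst (p ≤ℚ_) (solve 2 (λ p q → p :+ (q :- p) := q) refl p q)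
  (subst (_≤ℚ p + (q - p)) (+-identityʳ p) (+-monoʳ-≤ p h))

0<-⇒< : ∀ {p q} → 0ℚ < q - p → p < q
0<-⇒< {p} {q} h = subst (p <_) (solve 2 (λ p q → p :+ (q :- p) := q) refl p q)
  (subst (_< p + (q - p)) (+-identityʳ p) (+-monoʳ-< p h))

≤⇒≯ : ∀ {p q} → p ≤ℚ q → ¬ q < p
≤⇒≯ p≤q q<p = <-irrefl refl (<-≤-trans q<p p≤q)

0≤-neg : ∀ {p} → p ≤ℚ 0ℚ → 0ℚ ≤ℚ - p
0≤-neg = neg-antimono-≤

recip : ∀ p → 0ℚ < p → ∃ λ q → 0ℚ < q × p * q ≡ 1ℚ
recip p 0<p = 1/ p , positive⁻¹ _ {{1/pos⇒pos p}} , *-inverseʳ p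
  where instance
    _ = positive 0<p
    _ = pos⇒nonZero p

toℚ-normal : ∀ m → toℚ m ≡ mkℚ (ℤ.+ m) 0 (coprime-sym (1-coprimeTo m))
toℚ-normal m = normalize-coprime (coprime-sym (1-coprimeTo m))

toℚ-+ : ∀ m n → toℚ (m ℕ.+ n) ≡ toℚ m + toℚ n
toℚ-+ m n = begin
  toℚ (m ℕ.+ n)
    ≡⟨ cong (λ z → z / 1) (cong₂ ℤ._+_ (sym (ℤ.*-identityʳ (ℤ.+ m))) (sym (ℤ.*-identityʳ (ℤ.+ n)))) ⟩
  (ℤ.+ m ℤ.* ℤ.+ 1 ℤ.+ ℤ.+ n ℤ.* ℤ.+ 1) / 1   ≡⟨ cong₂ _+_ (toℚ-normal m) (toℚ-normal n) ⟨
  toℚ m + toℚ n                               ∎ where open ≡-Reasoning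

0≤toℚ : ∀ m → 0ℚ ≤ℚ toℚ m
0≤toℚ m = nonNegative⁻¹ (toℚ m) {{normalize-nonNeg m 1}}

-- Finitely supported measures

-- `RAlg I O` unfolds to `W (DTree I O)`, so algorithms, input distributions and the multipliers of
-- the linear program share one calculus of expectations. No normalisation is built in.
W : Set → Set
W X = List (ℚ × X)

NonNeg : {X : Set} → W X → Set
NonNeg = All (λ p → 0ℚ ≤ℚ proj₁ p)

𝔼 : {X : Set} → W X → (X → ℚ) → ℚ
𝔼 [] F = 0ℚ
𝔼 ((w , x) ∷ A) F = w * F x + 𝔼 A F

Dist : {X : Set} → W X → Set
Dist A = NonNeg A × 𝔼 A (λ _ → 1ℚ) ≡ 1ℚ

scale : {X : Set} → ℚ → W X → W X
scale c = map (λ (w , x) → c * w , x)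

infixl 5 _>>=_
_>>=_ : {X Y : Set} → W X → (X → W Y) → W Y
[] >>= f = []
((w , x) ∷ A) >>= f = scale w (f x) ++ (A >>= f)

return : {X : Set} → X → W X
return x = (1ℚ , x) ∷ []

module _ {X : Set} where

  𝔼-cong : ∀ (A : W X) {F G} → (∀ x → F x ≡ G x) → 𝔼 A F ≡ 𝔼 A G
  𝔼-cong [] h = refl
  𝔼-cong ((w , x) ∷ A) h = cong₂ _+_ (cong (w *_) (h x)) (𝔼-cong A h)

  𝔼-mono : ∀ {A : W X} {F G} → NonNeg A → (∀ x → F x ≤ℚ G x) → 𝔼 A F ≤ℚ 𝔼 A G
  𝔼-mono [] h = ≤-refl
  𝔼-mono (w ∷ A) h = +-mono-≤ (*-monoˡ w (h _)) (𝔼-mono A h)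

  𝔼-+ : ∀ (A : W X) F G → 𝔼 A (λ x → F x + G x) ≡ 𝔼 A F + 𝔼 A G
  𝔼-+ [] F G = refl
  𝔼-+ ((w , x) ∷ A) F G rewrite 𝔼-+ A F G =
    solve 5 (λ w f g a b → w :* (f :+ g) :+ (a :+ b) := w :* f :+ a :+ (w :* g :+ b)) refl w (F x) (G x) (𝔼 A F) (𝔼 A G)

  𝔼-*ˡ : ∀ (A : W X) c F → 𝔼 A (λ x → c * F x) ≡ c * 𝔼 A F
  𝔼-*ˡ [] c F = sym (*-zeroʳ c)
  𝔼-*ˡ ((w , x) ∷ A) c F rewrite 𝔼-*ˡ A c F =
    solve 4 (λ w f c a → w :* (c :* f) :+ c :* a := c :* (w :* f :+ a)) refl w (F x) c (𝔼 A F)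

  𝔼-*ʳ : ∀ (A : W X) c F → 𝔼 A (λ x → F x * c) ≡ 𝔼 A F * c
  𝔼-*ʳ A c F = trans (𝔼-cong A (λ x → *-comm (F x) c)) (trans (𝔼-*ˡ A c F) (*-comm c _))

  𝔼-const : ∀ {A : W X} → Dist A → ∀ c → 𝔼 A (λ _ → c) ≡ c
  𝔼-const {A} (_ , total) c = begin
    𝔼 A (λ _ → c)       ≡⟨ 𝔼-cong A (λ _ → sym (*-identityʳ c)) ⟩
    𝔼 A (λ _ → c * 1ℚ)  ≡⟨ 𝔼-*ˡ A c _ ⟩
    c * 𝔼 A (λ _ → 1ℚ)  ≡⟨ cong (c *_) total ⟩
    c * 1ℚ              ≡⟨ *-identityʳ c ⟩
    c                   ∎ where open ≡-Reasoning

  𝔼-≤ : ∀ {A : W X} {F c} → Dist A → (∀ x → F x ≤ℚ c) → 𝔼 A F ≤ℚ c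
  𝔼-≤ D h = ≤-trans (𝔼-mono (proj₁ D) h) (≤-reflexive (𝔼-const D _))

  𝔼-zero : ∀ (A : W X) → 𝔼 A (λ _ → 0ℚ) ≡ 0ℚ
  𝔼-zero [] = refl
  𝔼-zero ((w , x) ∷ A) rewrite 𝔼-zero A | *-zeroʳ w = refl

  0≤-𝔼 : ∀ {A : W X} {F} → NonNeg A → (∀ x → 0ℚ ≤ℚ F x) → 0ℚ ≤ℚ 𝔼 A F
  0≤-𝔼 {A} nn h = ≤-trans (≤-reflexive (sym (𝔼-zero A))) (𝔼-mono nn h)

  -- Positivity of `F` is asked only at the listed points, since the minimax argument controls `F`
  -- only on a fixed list of strategies. Entries of weight 0 are skipped; positive total mass
  -- guarantees that one of positive weight is met.
  0<-𝔼 : ∀ {A : W X} {F} → NonNeg A → 0ℚ < 𝔼 A (λ _ → 1ℚ) → All (λ p → 0ℚ < F (proj₂ p)) A → 0ℚ < 𝔼 A F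
  0<-𝔼 [] total [] = contradiction total (<-irrefl refl)
  0<-𝔼 {(w , x) ∷ A} {F} (hw ∷ nn) total (hx ∷ pos) with <-cmp 0ℚ w
  ... | tri< 0<w _ _ = 0<-+ˡ (0<-* 0<w hx) (tail-nonNeg nn pos)
    where
    tail-nonNeg : ∀ {A : W X} → NonNeg A → All (λ p → 0ℚ < F (proj₂ p)) A → 0ℚ ≤ℚ 𝔼 A F
    tail-nonNeg [] [] = ≤-refl
    tail-nonNeg (hw ∷ nn) (hx ∷ pos) = 0≤-+ (0≤-* hw (<⇒≤ hx)) (tail-nonNeg nn pos)
  ... | tri≈ _ refl _ = subst (0ℚ <_) (drop (F x) (𝔼 A F))
          (0<-𝔼 nn (subst (0ℚ <_) (sym (drop 1ℚ _)) total) pos)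
    where
    drop : ∀ p q → q ≡ 0ℚ * p + q
    drop = solve 2 (λ p q → q := con 0ℚ :* p :+ q) refl
  ... | tri> _ _ w<0 = contradiction w<0 (≤⇒≯ hw)

  𝔼-++ : ∀ (A B : W X) F → 𝔼 (A ++ B) F ≡ 𝔼 A F + 𝔼 B F
  𝔼-++ [] B F = sym (+-identityˡ _)
  𝔼-++ ((w , x) ∷ A) B F rewrite 𝔼-++ A B F = sym (+-assoc (w * F x) _ _)

  𝔼-scale : ∀ c (A : W X) F → 𝔼 (scale c A) F ≡ c * 𝔼 A F
  𝔼-scale c [] F = sym (*-zeroʳ c)
  𝔼-scale c ((w , x) ∷ A) F rewrite 𝔼-scale c A F =
    solve 4 (λ c w f a → c :* w :* f :+ c :* a := c :* (w :* f :+ a)) refl c w (F x) (𝔼 A F)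

  𝔼-return : ∀ (x : X) F → 𝔼 (return x) F ≡ F x
  𝔼-return x F = solve 1 (λ f → con 1ℚ :* f :+ con 0ℚ := f) refl (F x)

  return-dist : ∀ (x : X) → Dist (return x)
  return-dist x = (nonNegative⁻¹ 1ℚ ∷ []) , refl

  scale-nonNeg : ∀ {c} {A : W X} → 0ℚ ≤ℚ c → NonNeg A → NonNeg (scale c A)
  scale-nonNeg hc nn = map⁺ (All.map (0≤-* hc) nn)

module _ {X Y : Set} where

  𝔼-swap : ∀ (A : W X) (B : W Y) (F : X → Y → ℚ) →
           𝔼 A (λ x → 𝔼 B (F x)) ≡ 𝔼 B (λ y → 𝔼 A (λ x → F x y))
  𝔼-swap [] B F = sym (𝔼-zero B)
  𝔼-swap ((w , x) ∷ A) B F = begin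
    w * 𝔼 B (F x) + 𝔼 A (λ x → 𝔼 B (F x))
      ≡⟨ cong₂ _+_ (sym (𝔼-*ˡ B w (F x))) (𝔼-swap A B F) ⟩
    𝔼 B (λ y → w * F x y) + 𝔼 B (λ y → 𝔼 A (λ x → F x y))     ≡⟨ 𝔼-+ B _ _ ⟨
    𝔼 B (λ y → w * F x y + 𝔼 A (λ x → F x y))                  ∎ where open ≡-Reasoning

  𝔼->>= : ∀ (A : W X) (f : X → W Y) F → 𝔼 (A >>= f) F ≡ 𝔼 A (λ x → 𝔼 (f x) F)
  𝔼->>= [] f F = refl
  𝔼->>= ((w , x) ∷ A) f F = begin
    𝔼 (scale w (f x) ++ (A >>= f)) F      ≡⟨ 𝔼-++ (scale w (f x)) (A >>= f) F ⟩
    𝔼 (scale w (f x)) F + 𝔼 (A >>= f) F   ≡⟨ cong₂ _+_ (𝔼-scale w (f x) F) (𝔼->>= A f F) ⟩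
    w * 𝔼 (f x) F + 𝔼 A (λ x → 𝔼 (f x) F) ∎ where open ≡-Reasoning

  >>=-nonNeg : ∀ {A : W X} {f : X → W Y} → NonNeg A → (∀ x → NonNeg (f x)) → NonNeg (A >>= f)
  >>=-nonNeg [] h = []
  >>=-nonNeg (w ∷ nn) h = ++⁺ (scale-nonNeg w (h _)) (>>=-nonNeg nn h)

  >>=-dist : ∀ {A : W X} {f : X → W Y} → Dist A → (∀ x → Dist (f x)) → Dist (A >>= f)
  >>=-dist {A} {f} D h = >>=-nonNeg (proj₁ D) (proj₁ ∘ h) ,
    trans (𝔼->>= A f _) (trans (𝔼-cong A (proj₂ ∘ h)) (proj₂ D))

𝔼-map : ∀ {X Y : Set} (g : X → Y) (A : W X) F → 𝔼 (map (map₂ g) A) F ≡ 𝔼 A (F ∘ g)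
𝔼-map g [] F = refl
𝔼-map g ((w , x) ∷ A) F = cong (w * F (g x) +_) (𝔼-map g A F)

-- The weight is a parameter because two cases occur: 1 / k gives the uniform distribution, and 1
-- gives plain summation over `Fin k`.
unif : ℚ → ∀ k → W (Fin k)
unif w zero = []
unif w (suc k) = (w , zero) ∷ map (map₂ suc) (unif w k)

unif-nonNeg : ∀ {w} k → 0ℚ ≤ℚ w → NonNeg (unif w k)
unif-nonNeg zero hw = []
unif-nonNeg (suc k) hw = hw ∷ map⁺ (unif-nonNeg k hw)

𝔼-unif-total : ∀ w k → 𝔼 (unif w k) (λ _ → 1ℚ) ≡ toℚ k * w
𝔼-unif-total w zero = sym (*-zeroˡ w)
𝔼-unif-total w (suc k) = begin
  w * 1ℚ + 𝔼 (map (map₂ suc) (unif w k)) (λ _ → 1ℚ)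
    ≡⟨ cong (w * 1ℚ +_) (trans (𝔼-map suc (unif w k) _) (𝔼-unif-total w k)) ⟩
  w * 1ℚ + toℚ k * w
    ≡⟨ solve 2 (λ w k → w :* con 1ℚ :+ k :* w := (con 1ℚ :+ k) :* w) refl w (toℚ k) ⟩
  (1ℚ + toℚ k) * w                                   ≡⟨ cong (_* w) (toℚ-+ 1 k) ⟨
  toℚ (suc k) * w                                    ∎ where open ≡-Reasoning

unif-dist : ∀ {w} k → 0ℚ ≤ℚ w → toℚ k * w ≡ 1ℚ → Dist (unif w k)
unif-dist {w} k hw kw≡1 = unif-nonNeg k hw , trans (𝔼-unif-total w k) kw≡1

𝔼-unif-single : ∀ w {k} (i : Fin k) (g : Fin k → ℚ) →
  𝔼 (unif w k) (λ j → if ⌊ j Fin.≟ i ⌋ then g j else 0ℚ) ≡ w * g i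
𝔼-unif-single w {suc k} zero g = begin
  w * g zero + 𝔼 (map (map₂ suc) (unif w k)) _
    ≡⟨ cong (w * g zero +_) (trans (𝔼-map suc (unif w k) _) (𝔼-zero (unif w k))) ⟩
  w * g zero + 0ℚ                               ≡⟨ +-identityʳ _ ⟩
  w * g zero                                    ∎ where open ≡-Reasoning
𝔼-unif-single w {suc k} (suc i) g = begin
  w * 0ℚ + 𝔼 (map (map₂ suc) (unif w k)) _
    ≡⟨ cong₂ _+_ (*-zeroʳ w) (𝔼-map suc (unif w k) _) ⟩
  0ℚ + 𝔼 (unif w k) (λ j → if ⌊ suc j Fin.≟ suc i ⌋ then g (suc j) else 0ℚ)
    ≡⟨ +-identityˡ _ ⟩
  𝔼 (unif w k) (λ j → if ⌊ suc j Fin.≟ suc i ⌋ then g (suc j) else 0ℚ)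
    ≡⟨ 𝔼-cong (unif w k) (λ j → cong (if_then g (suc j) else 0ℚ) (drop-suc j)) ⟩
  𝔼 (unif w k) (λ j → if ⌊ j Fin.≟ i ⌋ then g (suc j) else 0ℚ)
    ≡⟨ 𝔼-unif-single w i (g ∘ suc) ⟩
  w * g (suc i) ∎
  where
  open ≡-Reasoning
  drop-suc : ∀ j → ⌊ suc j Fin.≟ suc i ⌋ ≡ ⌊ j Fin.≟ i ⌋
  drop-suc j with j Fin.≟ i
  ... | yes _ = refl
  ... | no _ = refl

-- Nonnegativity lets all terms but one be dropped. This is where the minimax theorem pays its
-- factor `w`.
𝔼-unif-≥ : ∀ {w k} (i : Fin k) (g : Fin k → ℚ) → 0ℚ ≤ℚ w → (∀ j → 0ℚ ≤ℚ g j) → w * g i ≤ℚ 𝔼 (unif w k) g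
𝔼-unif-≥ {w} {k} i g hw hg =
  ≤-trans (≤-reflexive (sym (𝔼-unif-single w i g))) (𝔼-mono (unif-nonNeg k hw) pointwise)
  where
  pointwise : ∀ j → (if ⌊ j Fin.≟ i ⌋ then g j else 0ℚ) ≤ℚ g j
  pointwise j with j Fin.≟ i
  ... | yes _ = ≤-refl
  ... | no _ = hg j

module _ {X : Set} where

  𝔼-null : ∀ {A : W X} → NonNeg A → 𝔼 A (λ _ → 1ℚ) ≡ 0ℚ → ∀ F → 𝔼 A F ≡ 0ℚ
  𝔼-null [] total F = refl
  𝔼-null {(w , x) ∷ A} (hw ∷ nn) total F = begin
    w * F x + 𝔼 A F   ≡⟨ cong₂ (λ a b → a * F x + b) w≡0 (𝔼-null nn rest≡0 F) ⟩
    0ℚ * F x + 0ℚ     ≡⟨ solve 1 (λ f → con 0ℚ :* f :+ con 0ℚ := con 0ℚ) refl (F x) ⟩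
    0ℚ                ∎
    where
    open ≡-Reasoning
    rest = 𝔼 A (λ _ → 1ℚ)
    0≤rest : 0ℚ ≤ℚ rest
    0≤rest = 0≤-𝔼 nn (λ _ → nonNegative⁻¹ 1ℚ)
    w≡0 : w ≡ 0ℚ
    w≡0 = ≤-antisym (≤-trans (0≤-⇒≤ (subst (0ℚ ≤ℚ_)
      (solve 2 (λ w r → r := w :* con 1ℚ :+ r :- w) refl w rest) 0≤rest)) (≤-reflexive total)) hw
    rest≡0 : rest ≡ 0ℚ
    rest≡0 = ≤-antisym (≤-trans (0≤-⇒≤ (subst (0ℚ ≤ℚ_)
      (solve 2 (λ w r → w := w :* con 1ℚ :+ r :- r) refl w rest) hw)) (≤-reflexive total)) 0≤rest

  -- A measure of mass 0 cannot be rescaled; any distribution then satisfies the equation, as both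
  -- sides vanish, and the point mass at the given element serves as default.
  normalised : X → ∀ {A : W X} → NonNeg A → ∃ λ B → Dist B × ∀ F → 𝔼 A F ≡ 𝔼 A (λ _ → 1ℚ) * 𝔼 B F
  normalised x {A} nn with <-cmp 0ℚ (𝔼 A (λ _ → 1ℚ))
  ... | tri< 0<L _ _ = let (c , c>0 , Lc≡1) = recip L 0<L in scale c A ,
          (scale-nonNeg (<⇒≤ c>0) nn , trans (𝔼-scale c A _) (trans (*-comm c L) Lc≡1)) ,
          λ F → begin
            𝔼 A F                  ≡⟨ *-identityˡ _ ⟨
            1ℚ * 𝔼 A F             ≡⟨ cong (_* 𝔼 A F) Lc≡1 ⟨
            L * c * 𝔼 A F          ≡⟨ *-assoc L c _ ⟩
            L * (c * 𝔼 A F)        ≡⟨ cong (L *_) (𝔼-scale c A F) ⟨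
            L * 𝔼 (scale c A) F    ∎
    where
    open ≡-Reasoning
    L = 𝔼 A (λ _ → 1ℚ)
  ... | tri≈ _ 0≡L _ = return x , return-dist x , λ F →
          trans (𝔼-null nn (sym 0≡L) F) (trans (sym (*-zeroˡ (𝔼 (return x) F))) (cong (_* 𝔼 (return x) F) 0≡L))
  ... | tri> _ _ L<0 = contradiction (≤-<-trans (0≤-𝔼 nn (λ _ → nonNegative⁻¹ 1ℚ)) L<0) (<-irrefl refl)

  𝔼-minus : ∀ {A : W X} → Dist A → ∀ F c → 𝔼 A (λ x → F x - c) ≡ 𝔼 A F - c
  𝔼-minus {A} D F c = trans (𝔼-+ A F (λ _ → - c)) (cong (𝔼 A F +_) (𝔼-const D (- c)))

  -- Entries with another index keep their place with weight 0 instead of being filtered out, so the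
  -- part of a cons reduces to a cons.
  part : ∀ {d} → Fin d → W (Fin d × X) → W X
  part i = map (λ (w , j , x) → (if ⌊ i Fin.≟ j ⌋ then w else 0ℚ) , x)

  part-nonNeg : ∀ {d} (i : Fin d) {A : W (Fin d × X)} → NonNeg A → NonNeg (part i A)
  part-nonNeg {d} i nn = map⁺ (All.map (λ {p} → keep {p}) nn)
    where
    keep : ∀ {p : ℚ × Fin d × X} → 0ℚ ≤ℚ proj₁ p → 0ℚ ≤ℚ (if ⌊ i Fin.≟ proj₁ (proj₂ p) ⌋ then proj₁ p else 0ℚ)
    keep {p} h with i Fin.≟ proj₁ (proj₂ p)
    ... | yes _ = h
    ... | no _ = ≤-refl

  𝔼-parts : ∀ {d} (A : W (Fin d × X)) F → 𝔼 A F ≡ 𝔼 (unif 1ℚ d) (λ i → 𝔼 (part i A) (λ x → F (i , x)))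
  𝔼-parts {d} [] F = sym (𝔼-zero (unif 1ℚ d))
  𝔼-parts {d} ((w , j , x) ∷ A) F = begin
    w * F (j , x) + 𝔼 A F
      ≡⟨ cong₂ _+_ (sym (*-identityˡ (w * F (j , x)))) (𝔼-parts A F) ⟩
    1ℚ * (w * F (j , x)) + 𝔼 (unif 1ℚ d) (λ i → 𝔼 (part i A) (λ x → F (i , x)))
      ≡⟨ cong (_+ _) (𝔼-unif-single 1ℚ j (λ i → w * F (i , x))) ⟨
    𝔼 (unif 1ℚ d) (λ i → if ⌊ i Fin.≟ j ⌋ then w * F (i , x) else 0ℚ) + 𝔼 (unif 1ℚ d) (λ i → 𝔼 (part i A) (λ x → F (i , x)))
      ≡⟨ 𝔼-+ (unif 1ℚ d) _ _ ⟨
    𝔼 (unif 1ℚ d) (λ i → (if ⌊ i Fin.≟ j ⌋ then w * F (i , x) else 0ℚ) + 𝔼 (part i A) (λ x → F (i , x)))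
      ≡⟨ 𝔼-cong (unif 1ℚ d) (λ i → cong (_+ _) (inside i)) ⟩
    𝔼 (unif 1ℚ d) (λ i → 𝔼 (part i ((w , j , x) ∷ A)) (λ x → F (i , x)))
      ∎
    where
    open ≡-Reasoning
    inside : ∀ i → (if ⌊ i Fin.≟ j ⌋ then w * F (i , x) else 0ℚ) ≡ (if ⌊ i Fin.≟ j ⌋ then w else 0ℚ) * F (i , x)
    inside i with i Fin.≟ j
    ... | yes _ = refl
    ... | no _ = sym (*-zeroˡ (F (i , x)))

-- The minimax theorem

-- `K` is an abstract convex cone: `comb a p b q` plays the role of a p + b q, and each `j` acts on
-- it as a linear functional through `val`. Later `K` is the type of measures on pure strategies.
module Alternative {K J : Set} (val : K → J → ℚ) (comb : ℚ → K → ℚ → K → K)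
  (val-comb : ∀ a p b q j → val (comb a p b q) j ≡ a * val p j + b * val q j) where

  positives negatives : J → List K → List K
  positives j = filter (λ v → 0ℚ <? val v j)
  negatives j = filter (λ v → ¬? (0ℚ <? val v j))

  -- The coefficients make the value at `j` vanish. For `p` positive and `n` nonpositive at `j`, the
  -- first is nonnegative and the second strictly positive, which is the asymmetric closure property
  -- demanded of `C`.
  cancel : J → K → K → K
  cancel j p n = comb (- val n j) p (val p j) n

  -- `l` is the maximum of 0 and the ratios - s p / val p j, built up along the list. The last
  -- component records where the maximum is attained, which is needed to compare `l` with the upper
  -- bounds coming from the negatives.
  threshold : (j : J) (s : K → ℚ) (Ps : List K) → (∀ {p} → p ∈ Ps → 0ℚ < val p j) →
    ∃ λ l → 0ℚ ≤ℚ l × (∀ {p} → p ∈ Ps → 0ℚ ≤ℚ l * val p j + s p) ×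
            (l ≡ 0ℚ ⊎ ∃ λ p → p ∈ Ps × l * val p j + s p ≡ 0ℚ)
  threshold j s [] pos = 0ℚ , ≤-refl , (λ ()) , inj₁ refl
  threshold j s (p ∷ Ps) pos with threshold j s Ps (pos ∘ there)
  ... | l , l≥0 , all , tight with ≤-total 0ℚ (l * val p j + s p)
  ...   | inj₁ ok = l , l≥0 , (λ { (here refl) → ok ; (there q) → all q }) ,
                    Sum.map₂ (map₂ (λ (q , e) → there q , e)) tight
  ...   | inj₂ bad with recip (val p j) (pos (here refl))
  ...     | b , b>0 , vb≡1 = l′ , ≤-trans l≥0 l≤l′ ,
            (λ { (here refl) → ≤-reflexive (sym eq)
               ; (there q) → ≤-trans (all q) (+-monoˡ-≤ (s _) (*-monoʳ (<⇒≤ (pos (there q))) l≤l′)) }) ,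
            inj₂ (p , here refl , eq)
    where
    v = val p j
    l′ = - (s p * b)
    eq : l′ * v + s p ≡ 0ℚ
    eq = begin
      - (s p * b) * v + s p
        ≡⟨ solve 3 (λ s b v → :- (s :* b) :* v :+ s := s :* (con 1ℚ :- v :* b)) refl (s p) b v ⟩
      s p * (1ℚ - v * b)       ≡⟨ cong (λ z → s p * (1ℚ - z)) vb≡1 ⟩
      s p * 0ℚ                 ≡⟨ *-zeroʳ (s p) ⟩
      0ℚ                       ∎ where open ≡-Reasoning
    l≤l′ : l ≤ℚ l′
    l≤l′ = 0≤-⇒≤ (subst (0ℚ ≤ℚ_) lemma (0≤-* (<⇒≤ b>0) (0≤-neg bad)))
      where
      open ≡-Reasoning
      lemma : b * - (l * v + s p) ≡ l′ - l
      lemma = begin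
        b * - (l * v + s p)
          ≡⟨ solve 4 (λ b l v s → b :* :- (l :* v :+ s) := :- (s :* b) :- l :* (v :* b)) refl b l v (s p) ⟩
        - (s p * b) - l * (v * b)                 ≡⟨ cong (λ z → - (s p * b) - l * z) vb≡1 ⟩
        - (s p * b) - l * 1ℚ                      ≡⟨ cong (λ z → - (s p * b) - z) (*-identityʳ l) ⟩
        - (s p * b) - l                           ∎

  -- Finitely many strict inequalities survive a small increase of `l`. The increase turns the weak
  -- inequalities of `threshold` at the positives into strict ones.
  slack : (j : J) (s : K → ℚ) (l : ℚ) (Ns : List K) →
    (∀ {n} → n ∈ Ns → val n j ≤ℚ 0ℚ × 0ℚ < l * val n j + s n) →
    ∃ λ d → 0ℚ < d × (∀ {n} → n ∈ Ns → 0ℚ < (l + d) * val n j + s n)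
  slack j s l [] h = 1ℚ , positive⁻¹ 1ℚ , λ ()
  slack j s l (n ∷ Ns) h with slack j s l Ns (h ∘ there)
  ... | d , d>0 , all with recip (1ℚ - val n j) 0<1-v
    where
    0<1-v : 0ℚ < 1ℚ - val n j
    0<1-v = <-≤-trans (positive⁻¹ 1ℚ) (+-monoʳ-≤ 1ℚ (0≤-neg (proj₁ (h (here refl)))))
  ...   | b , b>0 , vb≡1 = d ⊓ e , 0<d⊓e ,
          (λ { (here refl) → <-≤-trans head (shrink {n} (proj₁ (h (here refl))) (p⊓q≤q d e))
             ; (there q) → <-≤-trans (all q) (shrink (proj₁ (h (there q))) (p⊓q≤p d e)) })
    where
    v = val n j
    u = l * v + s n
    u>0 : 0ℚ < u
    u>0 = proj₂ (h (here refl))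
    -- Here `e` is u / (1 - v), so that the value after the increase, u + e v, is again `e`.
    -- Dividing by 1 - v rather than by - v also covers v = 0.
    e = u * b
    0<d⊓e : 0ℚ < d ⊓ e
    0<d⊓e with ≤-total d e
    ... | inj₁ d≤e = subst (0ℚ <_) (sym (p≤q⇒p⊓q≡p d≤e)) d>0
    ... | inj₂ e≤d = subst (0ℚ <_) (sym (p≥q⇒p⊓q≡q e≤d)) (0<-* u>0 b>0)
    shrink : ∀ {n d d′} → val n j ≤ℚ 0ℚ → d ≤ℚ d′ → (l + d′) * val n j + s n ≤ℚ (l + d) * val n j + s n
    shrink {n} {d} {d′} v≤0 d≤d′ = 0≤-⇒≤ (subst (0ℚ ≤ℚ_)
      (solve 5 (λ l d e v s → (:- v) :* (e :- d) := (l :+ d) :* v :+ s :- ((l :+ e) :* v :+ s)) refl l d d′ (val n j) (s n))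
      (0≤-* (0≤-neg v≤0) (≤⇒0≤- d≤d′)))
    head : 0ℚ < (l + e) * v + s n
    head = subst (0ℚ <_) (sym eq) (0<-* u>0 b>0)
      where
      open ≡-Reasoning
      eq : (l + e) * v + s n ≡ e
      eq = begin
        (l + u * b) * v + s n
          ≡⟨ solve 4 (λ l b v s → (l :+ (l :* v :+ s) :* b) :* v :+ s :=
                  (l :* v :+ s) :* b :+ (l :* v :+ s) :* (con 1ℚ :- (con 1ℚ :- v) :* b)) refl l b v (s n) ⟩
        u * b + u * (1ℚ - (1ℚ - v) * b)     ≡⟨ cong (λ z → u * b + u * (1ℚ - z)) vb≡1 ⟩
        u * b + u * 0ℚ                      ≡⟨ cong (u * b +_) (*-zeroʳ u) ⟩
        u * b + 0ℚ                          ≡⟨ +-identityʳ (u * b) ⟩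
        u * b                               ∎

  -- Fourier–Motzkin: eliminating the multiplier of j keeps the elements with val _ j ≤ 0 and
  -- adds, for each pair of opposite signs, the positive combination that vanishes at j.
  alternative : (js : List J) (C : K → Set) →
    (∀ {a p b q} → 0ℚ ≤ℚ a → 0ℚ < b → C p → C q → C (comb a p b q)) →
    (V : List K) → (∀ {v} → v ∈ V → C v) →
    (∃ λ v → C v × All (λ j → val v j ≤ℚ 0ℚ) js) ⊎
    (∃ λ (m : W J) → NonNeg m × (∀ {v} → v ∈ V → 0ℚ < 𝔼 m (val v)))
  alternative [] C closed [] h = inj₂ ([] , [] , λ ())
  alternative [] C closed (v ∷ V) h = inj₁ (v , h (here refl) , [])
  -- Strengthening `C` by the condition at `j` makes any element found by the recursive call satisfy
  -- that condition too.
  alternative (j ∷ js) C closed V h with alternative js (λ v → C v × val v j ≤ℚ 0ℚ) closed′ V′ h′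
    where
    V′ = negatives j V ++ cartesianProductWith (cancel j) (positives j V) (negatives j V)
    closed′ : ∀ {a p b q} → 0ℚ ≤ℚ a → 0ℚ < b → C p × val p j ≤ℚ 0ℚ → C q × val q j ≤ℚ 0ℚ →
              C (comb a p b q) × val (comb a p b q) j ≤ℚ 0ℚ
    closed′ {a} {p} {b} {q} ha hb (cp , vp) (cq , vq) = closed ha hb cp cq ,
      subst (_≤ℚ 0ℚ) (sym (val-comb a p b q j)) (0≤-⇒≤ (subst (0ℚ ≤ℚ_)
        (solve 4 (λ a p b q → a :* (:- p) :+ b :* (:- q) := con 0ℚ :- (a :* p :+ b :* q)) refl a (val p j) b (val q j))
        (0≤-+ (0≤-* ha (0≤-neg vp)) (0≤-* (<⇒≤ hb) (0≤-neg vq)))))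
    h′ : ∀ {v} → v ∈ V′ → C v × val v j ≤ℚ 0ℚ
    h′ v∈ with ∈-++⁻ (negatives j V) v∈
    ... | inj₁ v∈N = let (v∈V , v≤0) = ∈-filter⁻ (λ v → ¬? (0ℚ <? val v j)) {xs = V} v∈N in h v∈V , ≮⇒≥ v≤0
    ... | inj₂ v∈P with ∈-cartesianProductWith⁻ (cancel j) (positives j V) (negatives j V) v∈P
    ...   | p , n , p∈ , n∈ , refl =
            let (p∈V , p>0) = ∈-filter⁻ (λ v → 0ℚ <? val v j) {xs = V} p∈
                (n∈V , n≤0) = ∈-filter⁻ (λ v → ¬? (0ℚ <? val v j)) {xs = V} n∈
            in closed (0≤-neg (≮⇒≥ n≤0)) p>0 (h p∈V) (h n∈V) ,
               ≤-reflexive (trans (val-comb _ p _ n j)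
                 (solve 2 (λ p n → (:- n) :* p :+ p :* n := con 0ℚ) refl (val p j) (val n j)))
  ... | inj₁ (v , (cv , vj) , all) = inj₁ (v , cv , vj ∷ all)
  ... | inj₂ (m , m≥0 , pos) with threshold j s (positives j V) pos-Pos
    where
    s : K → ℚ
    s v = 𝔼 m (val v)
    pos-Pos : ∀ {p} → p ∈ positives j V → 0ℚ < val p j
    pos-Pos p∈ = proj₂ (∈-filter⁻ (λ v → 0ℚ <? val v j) {xs = V} p∈)
  ...   | l , l≥0 , lower , tight = inj₂ (((l + d , j) ∷ m) , (≤-trans l≥0 l≤l+d ∷ m≥0) , all)
    where
    s : K → ℚ
    s v = 𝔼 m (val v)
    𝔼-comb : ∀ a p b q → s (comb a p b q) ≡ a * s p + b * s q
    𝔼-comb a p b q = begin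
      𝔼 m (val (comb a p b q))                       ≡⟨ 𝔼-cong m (val-comb a p b q) ⟩
      𝔼 m (λ j → a * val p j + b * val q j)           ≡⟨ 𝔼-+ m _ _ ⟩
      𝔼 m (λ j → a * val p j) + 𝔼 m (λ j → b * val q j) ≡⟨ cong₂ _+_ (𝔼-*ˡ m a _) (𝔼-*ˡ m b _) ⟩
      a * s p + b * s q                               ∎ where open ≡-Reasoning
    neg-at-l : ∀ {n} → n ∈ negatives j V → val n j ≤ℚ 0ℚ × 0ℚ < l * val n j + s n
    neg-at-l {n} n∈ = n≤0 , at-l tight
      where
      n≤0 = ≮⇒≥ (proj₂ (∈-filter⁻ (λ v → ¬? (0ℚ <? val v j)) {xs = V} n∈))
      at-l : l ≡ 0ℚ ⊎ (∃ λ p → p ∈ positives j V × l * val p j + s p ≡ 0ℚ) → 0ℚ < l * val n j + s n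
      at-l (inj₁ refl) = subst (0ℚ <_) (solve 2 (λ v s → s := con 0ℚ :* v :+ s) refl (val n j) (s n)) (pos (∈-++⁺ˡ n∈))
      -- When `l` is attained at `p`, the strict inequality for the pair `cancel j p n` supplies
      -- strictness at `n`: the contribution of `p` is 0, so the value of the pair is `val p j`
      -- times the value wanted.
      at-l (inj₂ (p , p∈ , eq)) = *-cancelˡ-<-nonNeg (val p j) {{nonNegative (<⇒≤ p>0)}}
        (subst (_< val p j * (l * val n j + s n)) (sym (*-zeroʳ (val p j))) (subst (0ℚ <_) rearrange pair>0))
        where
        open ≡-Reasoning
        p>0 = proj₂ (∈-filter⁻ (λ v → 0ℚ <? val v j) {xs = V} p∈)
        pair>0 : 0ℚ < s (cancel j p n)
        pair>0 = pos (∈-++⁺ʳ (negatives j V) (∈-cartesianProductWith⁺ (cancel j) p∈ n∈))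
        rearrange : s (cancel j p n) ≡ val p j * (l * val n j + s n)
        rearrange = begin
          s (cancel j p n)                                  ≡⟨ 𝔼-comb _ p _ n ⟩
          - val n j * s p + val p j * s n
            ≡⟨ solve 5 (λ l x y sp sn → :- y :* sp :+ x :* sn := x :* (l :* y :+ sn) :- y :* (l :* x :+ sp)) refl
                    l (val p j) (val n j) (s p) (s n) ⟩
          val p j * (l * val n j + s n) - val n j * (l * val p j + s p)
            ≡⟨ cong (λ z → val p j * (l * val n j + s n) - val n j * z) eq ⟩
          val p j * (l * val n j + s n) - val n j * 0ℚ
            ≡⟨ solve 2 (λ x y → x :- y :* con 0ℚ := x) refl (val p j * (l * val n j + s n)) (val n j) ⟩
          val p j * (l * val n j + s n)                   ∎
    step = slack j s l (negatives j V) neg-at-l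
    d = proj₁ step
    d>0 = proj₁ (proj₂ step)
    l≤l+d : l ≤ℚ l + d
    l≤l+d = subst (_≤ℚ l + d) (+-identityʳ l) (+-monoʳ-≤ l (<⇒≤ d>0))
    all : ∀ {v} → v ∈ V → 0ℚ < (l + d) * val v j + s v
    all {v} v∈ with 0ℚ <? val v j
    ... | no ¬v>0 = proj₂ (proj₂ step) (∈-filter⁺ (λ v → ¬? (0ℚ <? val v j)) v∈ ¬v>0)
    ... | yes v>0 = subst (0ℚ <_)
            (solve 4 (λ l d v s → (l :* v :+ s) :+ d :* v := (l :+ d) :* v :+ s) refl l d (val v j) (s v))
            (0<-+ʳ (lower (∈-filter⁺ (λ v → 0ℚ <? val v j) v∈ v>0)) (0<-* d>0 v>0))

module _ {X Y : Set} {d : ℕ} (h : Fin d → X → Y → ℚ) (h≥0 : ∀ i x y → 0ℚ ≤ℚ h i x y)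
  (bound : Fin d → ℚ) (w : ℚ) (0<w : 0ℚ < w) (dw≡1 : toℚ d * w ≡ 1ℚ) where

  -- A violation of the bounds yields one distribution per payoff; answering their average costs
  -- only the factor d = 1 / w in each payoff.
  simultaneous-minimax : (xs : List X) (ys : List Y) → (∀ y → y ∈ ys) → Y →
    (∀ μ → Dist μ → ∃ λ A → Dist A × All (λ p → proj₂ p ∈ xs) A × ∀ i → 𝔼 A (λ x → 𝔼 μ (h i x)) ≤ℚ w * bound i) →
    ∃ λ M → Dist M × ∀ i y → 𝔼 M (λ x → h i x y) ≤ℚ bound i
  simultaneous-minimax xs ys complete y₀ respond
    -- The generators are the point masses on `xs`. Positive total mass is part of `C` so that a
    -- measure found in the first alternative can be normalised.
    with alternative js C closed (map return xs) returns
    where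
    js = List.cartesianProduct (List.allFin d) ys
    C : W X → Set
    C A = NonNeg A × 0ℚ < 𝔼 A (λ _ → 1ℚ)
    val : W X → Fin d × Y → ℚ
    val A (i , y) = 𝔼 A (λ x → h i x y - bound i)
    comb : ℚ → W X → ℚ → W X → W X
    comb a A b B = scale a A ++ scale b B
    𝔼-comb : ∀ a A b B F → 𝔼 (comb a A b B) F ≡ a * 𝔼 A F + b * 𝔼 B F
    𝔼-comb a A b B F = trans (𝔼-++ (scale a A) (scale b B) F) (cong₂ _+_ (𝔼-scale a A F) (𝔼-scale b B F))
    open Alternative val comb (λ a A b B (i , y) → 𝔼-comb a A b B (λ x → h i x y - bound i))
    closed : ∀ {a A b B} → 0ℚ ≤ℚ a → 0ℚ < b → C A → C B → C (comb a A b B)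
    closed {a} {A} {b} {B} ha hb (nA , tA) (nB , tB) =
      ++⁺ (scale-nonNeg ha nA) (scale-nonNeg (<⇒≤ hb) nB) ,
      subst (0ℚ <_) (sym (𝔼-comb a A b B (λ _ → 1ℚ))) (0<-+ʳ (0≤-* ha (<⇒≤ tA)) (0<-* hb tB))
    returns : ∀ {A} → A ∈ map return xs → C A
    returns A∈ with ∈-map⁻ return A∈
    ... | x , _ , refl = proj₁ (return-dist x) , positive⁻¹ 1ℚ
  ... | inj₁ (A , (nn , 0<L) , ok) =
      let (c , c>0 , Lc≡1) = recip (𝔼 A (λ _ → 1ℚ)) 0<L
          D : Dist (scale c A)
          D = scale-nonNeg (<⇒≤ c>0) nn , trans (𝔼-scale c A _) (trans (*-comm c _) Lc≡1)
      in scale c A , D , λ i y → 0≤-⇒≤ (subst (0ℚ ≤ℚ_)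
           (begin
              c * - 𝔼 A (λ x → h i x y - bound i)           ≡⟨ neg-distribʳ-* c _ ⟨
              - (c * 𝔼 A (λ x → h i x y - bound i))         ≡⟨ cong -_ (𝔼-scale c A _) ⟨
              - 𝔼 (scale c A) (λ x → h i x y - bound i)
                ≡⟨ cong -_ (𝔼-minus D (λ x → h i x y) (bound i)) ⟩
              - (𝔼 (scale c A) (λ x → h i x y) - bound i)
                ≡⟨ solve 2 (λ p b → :- (p :- b) := b :- p) refl (𝔼 (scale c A) (λ x → h i x y)) (bound i) ⟩
              bound i - 𝔼 (scale c A) (λ x → h i x y)       ∎)
           (0≤-* (<⇒≤ c>0) (0≤-neg (All.lookup ok (∈-cartesianProductWith⁺ _,_ (∈-allFin i) (complete y))))))
    where
    open ≡-Reasoning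
  ... | inj₂ (m , m≥0 , pos) = contradiction (<-≤-trans value>0 value≤0) (<-irrefl refl)
    where
    normal : ∀ i → ∃ λ μ → Dist μ × ∀ F → 𝔼 (part i m) F ≡ 𝔼 (part i m) (λ _ → 1ℚ) * 𝔼 μ F
    normal i = normalised y₀ (part-nonNeg i m≥0)
    μᵢ : Fin d → W Y
    μᵢ i = proj₁ (normal i)
    μᵢ-dist : ∀ i → Dist (μᵢ i)
    μᵢ-dist i = proj₁ (proj₂ (normal i))
    μ : W Y
    μ = unif w d >>= μᵢ
    response = respond μ (>>=-dist (unif-dist d (<⇒≤ 0<w) dw≡1) μᵢ-dist)
    A = proj₁ response
    A-dist = proj₁ (proj₂ response)
    -- The contradiction comes from evaluating this in two orders. It is positive because the
    -- response `A` is supported on `xs`, and nonpositive because, split by payoff, each part of `m`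
    -- is a multiple of `μᵢ i`, against which `A` meets `bound i`.
    value = 𝔼 A (λ x → 𝔼 m (λ (i , y) → h i x y - bound i))
    value>0 : 0ℚ < value
    value>0 = 0<-𝔼 (proj₁ A-dist) (subst (0ℚ <_) (sym (proj₂ A-dist)) (positive⁻¹ 1ℚ))
      (All.map (λ {p} x∈ → subst (0ℚ <_)
        (𝔼-cong m (λ (i , y) → 𝔼-return (proj₂ p) (λ x → h i x y - bound i))) (pos (∈-map⁺ return x∈)))
        (proj₁ (proj₂ (proj₂ response))))
    H : Fin d → Y → ℚ
    H i y = 𝔼 A (λ x → h i x y)
    H≥0 : ∀ i y → 0ℚ ≤ℚ H i y
    H≥0 i y = 0≤-𝔼 (proj₁ A-dist) (λ x → h≥0 i x y)
    𝔼μᵢ≤ : ∀ i → 𝔼 (μᵢ i) (H i) ≤ℚ bound i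
    𝔼μᵢ≤ i = *-cancelˡ-≤-pos w {{positive 0<w}} (begin
      w * 𝔼 (μᵢ i) (H i)
        ≤⟨ 𝔼-unif-≥ i (λ j → 𝔼 (μᵢ j) (H i)) (<⇒≤ 0<w) (λ j → 0≤-𝔼 (proj₁ (μᵢ-dist j)) (H≥0 i)) ⟩
      𝔼 (unif w d) (λ j → 𝔼 (μᵢ j) (H i))    ≡⟨ 𝔼->>= (unif w d) μᵢ (H i) ⟨
      𝔼 μ (H i)                              ≡⟨ 𝔼-swap A μ (h i) ⟨
      𝔼 A (λ x → 𝔼 μ (h i x))                ≤⟨ proj₂ (proj₂ (proj₂ response)) i ⟩
      w * bound i                            ∎) where open ≤-Reasoning
    part≤0 : ∀ i → 𝔼 (part i m) (λ y → H i y - bound i) ≤ℚ 0ℚ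
    part≤0 i = begin
      𝔼 (part i m) (λ y → H i y - bound i)     ≡⟨ proj₂ (proj₂ (normal i)) _ ⟩
      L * 𝔼 (μᵢ i) (λ y → H i y - bound i)     ≡⟨ cong (L *_) (𝔼-minus (μᵢ-dist i) (H i) (bound i)) ⟩
      L * (𝔼 (μᵢ i) (H i) - bound i)
        ≤⟨ *-monoˡ (0≤-𝔼 (part-nonNeg i m≥0) (λ _ → nonNegative⁻¹ 1ℚ)) (+-monoˡ-≤ (- bound i) (𝔼μᵢ≤ i)) ⟩
      L * (bound i - bound i)
        ≡⟨ solve 2 (λ l b → l :* (b :- b) := con 0ℚ) refl L (bound i) ⟩
      0ℚ                                       ∎
      where
      open ≤-Reasoning
      L = 𝔼 (part i m) (λ _ → 1ℚ)
    value≤0 : value ≤ℚ 0ℚ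
    value≤0 = begin
      value
        ≡⟨ 𝔼-swap A m (λ x (i , y) → h i x y - bound i) ⟩
      𝔼 m (λ (i , y) → 𝔼 A (λ x → h i x y - bound i))
        ≡⟨ 𝔼-cong m (λ (i , y) → 𝔼-minus A-dist (λ x → h i x y) (bound i)) ⟩
      𝔼 m (λ (i , y) → H i y - bound i)                                 ≡⟨ 𝔼-parts m _ ⟩
      𝔼 (unif 1ℚ d) (λ i → 𝔼 (part i m) (λ y → H i y - bound i))
        ≤⟨ 𝔼-mono (unif-nonNeg d (nonNegative⁻¹ 1ℚ)) part≤0 ⟩
      𝔼 (unif 1ℚ d) (λ _ → 0ℚ)                                          ≡⟨ 𝔼-zero (unif 1ℚ d) ⟩
      0ℚ                                                                ∎ where open ≤-Reasoning

-- Planting one instance among k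

eval-cong : ∀ {I O : Set} (t : DTree I O) {x y : I → Bool} → x ≗ y → eval t x ≡ eval t y
eval-cong (leaf o) x≗y = refl
eval-cong (node i t₀ t₁) {x} x≗y rewrite sym (x≗y i) with x i
... | true = eval-cong t₁ x≗y
... | false = eval-cong t₀ x≗y

queries-cong : ∀ {I O : Set} (t : DTree I O) {x y : I → Bool} → x ≗ y → queries t x ≡ queries t y
queries-cong (leaf o) x≗y = refl
queries-cong (node i t₀ t₁) {x} x≗y rewrite sym (x≗y i) with x i
... | true = cong suc (queries-cong t₁ x≗y)
... | false = cong suc (queries-cong t₀ x≗y)

mismatch : {O : Set} → DecidableEquality O → O → O → ℚ
mismatch _≟_ v o = if ⌊ o ≟ v ⌋ then 0ℚ else 1ℚ

module _ {I O : Set} where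

  totalWeight≡𝔼 : (A : RAlg I O) → totalWeight A ≡ 𝔼 A (λ _ → 1ℚ)
  totalWeight≡𝔼 [] = refl
  totalWeight≡𝔼 ((w , t) ∷ A) = cong₂ _+_ (sym (*-identityʳ w)) (totalWeight≡𝔼 A)

  expQueries≡𝔼 : (A : RAlg I O) (x : I → Bool) → expQueries A x ≡ 𝔼 A (λ t → toℚ (queries t x))
  expQueries≡𝔼 [] x = refl
  expQueries≡𝔼 ((w , t) ∷ A) x = cong (w * toℚ (queries t x) +_) (expQueries≡𝔼 A x)

  errProb≡𝔼 : (_≟_ : DecidableEquality O) (A : RAlg I O) (x : I → Bool) (v : O) →
    errProb _≟_ A x v ≡ 𝔼 A (λ t → mismatch _≟_ v (eval t x))
  errProb≡𝔼 _≟_ [] x v = refl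
  errProb≡𝔼 _≟_ ((w , t) ∷ A) x v with eval t x ≟ v
  ... | yes _ = cong₂ _+_ (sym (*-zeroʳ w)) (errProb≡𝔼 _≟_ A x v)
  ... | no _ = cong₂ _+_ (sym (*-identityʳ w)) (errProb≡𝔼 _≟_ A x v)

miss : Bool → Bool → ℚ
miss = mismatch Bool._≟_

aborted : Maybe Bool → ℚ
aborted (just _) = 0ℚ
aborted nothing = 1ℚ

wrong : Bool → Maybe Bool → ℚ
wrong v (just o) = miss v o
wrong v nothing = 0ℚ

0≤1 : 0ℚ ≤ℚ 1ℚ
0≤1 = nonNegative⁻¹ 1ℚ

0≤aborted : ∀ o → 0ℚ ≤ℚ aborted o
0≤aborted (just _) = ≤-refl
0≤aborted nothing = 0≤1

aborted≤1 : ∀ o → aborted o ≤ℚ 1ℚ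
aborted≤1 (just _) = 0≤1
aborted≤1 nothing = ≤-refl

0≤wrong : ∀ v o → 0ℚ ≤ℚ wrong v o
0≤wrong v nothing = ≤-refl
0≤wrong v (just o) with o Bool.≟ v
... | yes _ = ≤-refl
... | no _ = 0≤1

miss-refl : ∀ v → miss v v ≡ 0ℚ
miss-refl true = refl
miss-refl false = refl

_≟ᵛ_ : ∀ {k} → DecidableEquality (Vec Bool k)
_≟ᵛ_ = ≡-dec Bool._≟_

-- Discarding an output that follows a wrong one makes the errors at different coordinates disjoint.
label : ∀ {k} → Fin k → Vec Bool k → Vec Bool k → Maybe Bool
label zero (a ∷ as) (o ∷ os) = just o
label (suc i) (a ∷ as) (o ∷ os) = if ⌊ o Bool.≟ a ⌋ then label i as os else nothing

-- Only the answers before `i` are compared, so the planted instance can be labelled without knowing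
-- its correct answer.
label-[]≔ : ∀ {k} (i : Fin k) as b os → label i (as [ i ]≔ b) os ≡ label i as os
label-[]≔ zero (a ∷ as) b (o ∷ os) = refl
label-[]≔ (suc i) (a ∷ as) b (o ∷ os) = cong (if ⌊ o Bool.≟ a ⌋ then_else nothing) (label-[]≔ i as b os)

label-correct : ∀ {k} (i : Fin k) as → label i as as ≡ just (lookup as i)
label-correct zero (a ∷ as) = refl
label-correct (suc i) (a ∷ as) with a Bool.≟ a
... | yes _ = label-correct i as
... | no a≢a = contradiction refl a≢a

aborted-label : ∀ {k} (i : Fin k) as os → aborted (label i as os) ≤ℚ mismatch _≟ᵛ_ as os
aborted-label i as os with os ≟ᵛ as
... | yes refl = ≤-reflexive (cong aborted (label-correct i as))
... | no _ = aborted≤1 (label i as os)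

-- Only the first wrong output counts: coordinates before it are labelled correctly, and those after
-- it are labelled `nothing`, which `wrong` ignores.
wrong-label-total : ∀ {w} k → 0ℚ ≤ℚ w → (as os : Vec Bool k) →
  𝔼 (unif w k) (λ i → wrong (lookup as i) (label i as os)) ≤ℚ w
wrong-label-total zero hw [] [] = hw
wrong-label-total {w} (suc k) hw (a ∷ as) (o ∷ os)
  rewrite 𝔼-map {X = Fin k} suc (unif w k) (λ i → wrong (lookup (a ∷ as) i) (label i (a ∷ as) (o ∷ os)))
  with o Bool.≟ a
... | yes _ = begin
  w * 0ℚ + rest   ≡⟨ cong (_+ rest) (*-zeroʳ w) ⟩
  0ℚ + rest       ≡⟨ +-identityˡ rest ⟩
  rest            ≤⟨ wrong-label-total k hw as os ⟩
  w               ∎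
  where
  open ≤-Reasoning
  rest = 𝔼 (unif w k) (λ i → wrong (lookup as i) (label i as os))
... | no _ = ≤-reflexive (trans (cong₂ _+_ (*-identityʳ w) (𝔼-zero (unif w k))) (+-identityʳ w))

wrong-label : ∀ {w} k → 0ℚ ≤ℚ w → (as os : Vec Bool k) →
  𝔼 (unif w k) (λ i → wrong (lookup as i) (label i as os)) ≤ℚ w * mismatch _≟ᵛ_ as os
wrong-label {w} k hw as os with os ≟ᵛ as
... | no _ = ≤-trans (wrong-label-total k hw as os) (≤-reflexive (sym (*-identityʳ w)))
... | yes refl = ≤-reflexive (begin
  𝔼 (unif w k) (λ i → wrong (lookup as i) (label i as as))
    ≡⟨ 𝔼-cong (unif w k) (λ i → trans (cong (wrong (lookup as i)) (label-correct i as)) (miss-refl (lookup as i))) ⟩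
  𝔼 (unif w k) (λ _ → 0ℚ)                                   ≡⟨ 𝔼-zero (unif w k) ⟩
  0ℚ                                                        ≡⟨ *-zeroʳ w ⟨
  w * 0ℚ                                                    ∎) where open ≡-Reasoning

-- Inputs are represented by vectors because vectors can be enumerated; trees still query functions.
entries : ∀ {k n} → Vec (Vec Bool n) k → Fin k × Fin n → Bool
entries X (i , j) = lookup (lookup X i) j

module _ {k n : ℕ} where

  -- Queries to rows other than `i` are answered from `X` at no cost. The map `h` relabels the
  -- leaves, turning the vector of outputs into one answer or an abort.
  restrict : {O P : Set} → (O → P) → Fin k → Vec (Vec Bool n) k → DTree (Fin k × Fin n) O → DTree (Fin n) P
  restrict h i X (leaf o) = leaf (h o)
  restrict h i X (node (i′ , j) t₀ t₁) with i′ Fin.≟ i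
  ... | yes _ = node j (restrict h i X t₀) (restrict h i X t₁)
  ... | no _ = if lookup (lookup X i′) j then restrict h i X t₁ else restrict h i X t₀

  queriesTo : {O : Set} → Fin k → DTree (Fin k × Fin n) O → (Fin k × Fin n → Bool) → ℕ
  queriesTo i (leaf o) x = 0
  queriesTo i (node (i′ , j) t₀ t₁) x =
    (if ⌊ i Fin.≟ i′ ⌋ then 1 else 0) ℕ.+ (if x (i′ , j) then queriesTo i t₁ x else queriesTo i t₀ x)

  eval-restrict : {O P : Set} (h : O → P) (i : Fin k) (X : Vec (Vec Bool n) k)
    (t : DTree (Fin k × Fin n) O) (y : Vec Bool n) →
    eval (restrict h i X t) (lookup y) ≡ h (eval t (entries (X [ i ]≔ y)))
  eval-restrict h i X (leaf o) y = refl
  eval-restrict h i X (node (i′ , j) t₀ t₁) y with i′ Fin.≟ i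
  ... | yes refl rewrite lookup∘update i X y with lookup y j
  ...   | true = eval-restrict h i X t₁ y
  ...   | false = eval-restrict h i X t₀ y
  eval-restrict h i X (node (i′ , j) t₀ t₁) y | no i′≢i
    rewrite lookup∘update′ i′≢i X y with lookup (lookup X i′) j
  ...   | true = eval-restrict h i X t₁ y
  ...   | false = eval-restrict h i X t₀ y

  queries-restrict : {O P : Set} (h : O → P) (i : Fin k) (X : Vec (Vec Bool n) k)
    (t : DTree (Fin k × Fin n) O) (y : Vec Bool n) →
    queries (restrict h i X t) (lookup y) ≡ queriesTo i t (entries (X [ i ]≔ y))
  queries-restrict h i X (leaf o) y = refl
  queries-restrict h i X (node (i′ , j) t₀ t₁) y with i′ Fin.≟ i | i Fin.≟ i′
  ... | yes i′≡i | no i≢i′ = contradiction (sym i′≡i) i≢i′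
  ... | no i′≢i | yes i≡i′ = contradiction (sym i≡i′) i′≢i
  ... | yes refl | yes _ rewrite lookup∘update i X y with lookup y j
  ...   | true = cong suc (queries-restrict h i X t₁ y)
  ...   | false = cong suc (queries-restrict h i X t₀ y)
  queries-restrict h i X (node (i′ , j) t₀ t₁) y | no i′≢i | no _
    rewrite lookup∘update′ i′≢i X y with lookup (lookup X i′) j
  ...   | true = queries-restrict h i X t₁ y
  ...   | false = queries-restrict h i X t₀ y

  -- Each query goes to exactly one row, so the counts over all rows sum to the total. With `w` = 1
  -- / k this is the saving in queries.
  𝔼-queriesTo : ∀ {O : Set} w (t : DTree (Fin k × Fin n) O) x →
    𝔼 (unif w k) (λ i → toℚ (queriesTo i t x)) ≡ w * toℚ (queries t x)
  𝔼-queriesTo w (leaf o) x = trans (𝔼-zero (unif w k)) (sym (*-zeroʳ w))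
  𝔼-queriesTo w (node (i′ , j) t₀ t₁) x = begin
    𝔼 (unif w k) (λ i → toℚ ((if ⌊ i Fin.≟ i′ ⌋ then 1 else 0) ℕ.+ (if x (i′ , j) then queriesTo i t₁ x else queriesTo i t₀ x)))
      ≡⟨ 𝔼-cong (unif w k) (λ i → trans (toℚ-+ (if ⌊ i Fin.≟ i′ ⌋ then 1 else 0) _) (cong₂ _+_ (indicator i) (branch i))) ⟩
    𝔼 (unif w k) (λ i → (if ⌊ i Fin.≟ i′ ⌋ then 1ℚ else 0ℚ) + toℚ (queriesTo i t′ x))
      ≡⟨ 𝔼-+ (unif w k) _ _ ⟩
    𝔼 (unif w k) (λ i → if ⌊ i Fin.≟ i′ ⌋ then 1ℚ else 0ℚ) + 𝔼 (unif w k) (λ i → toℚ (queriesTo i t′ x))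
      ≡⟨ cong₂ _+_ (𝔼-unif-single w i′ (λ _ → 1ℚ)) below ⟩
    w * 1ℚ + w * toℚ (queries t′ x)
      ≡⟨ *-distribˡ-+ w 1ℚ _ ⟨
    w * (1ℚ + toℚ (queries t′ x))
      ≡⟨ cong (w *_) (toℚ-+ 1 (queries t′ x)) ⟨
    w * toℚ (suc (queries t′ x))
      ≡⟨ cong (λ m → w * toℚ (suc m)) branch′ ⟩
    w * toℚ (queries (node (i′ , j) t₀ t₁) x) ∎
    where
    open ≡-Reasoning
    t′ = if x (i′ , j) then t₁ else t₀
    below : 𝔼 (unif w k) (λ i → toℚ (queriesTo i t′ x)) ≡ w * toℚ (queries t′ x)
    below with x (i′ , j)
    ... | true = 𝔼-queriesTo w t₁ x
    ... | false = 𝔼-queriesTo w t₀ x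
    indicator : ∀ i → toℚ (if ⌊ i Fin.≟ i′ ⌋ then 1 else 0) ≡ (if ⌊ i Fin.≟ i′ ⌋ then 1ℚ else 0ℚ)
    indicator i with i Fin.≟ i′
    ... | yes _ = refl
    ... | no _ = refl
    branch : ∀ i → toℚ (if x (i′ , j) then queriesTo i t₁ x else queriesTo i t₀ x) ≡ toℚ (queriesTo i t′ x)
    branch i with x (i′ , j)
    ... | true = refl
    ... | false = refl
    branch′ : queries t′ x ≡ (if x (i′ , j) then queries t₁ x else queries t₀ x)
    branch′ with x (i′ , j)
    ... | true = refl
    ... | false = refl

-- Product measures and the planted algorithm

module _ {Y : Set} where

  -- The product measure of `k` independent copies of `μ`.
  power : W Y → ∀ k → W (Vec Y k)
  power μ zero = return []
  power μ (suc k) = μ >>= λ y → map (map₂ (y ∷_)) (power μ k)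

  𝔼-power-suc : ∀ μ k H → 𝔼 (power μ (suc k)) H ≡ 𝔼 μ (λ y → 𝔼 (power μ k) (λ X → H (y ∷ X)))
  𝔼-power-suc μ k H = trans (𝔼->>= μ _ H) (𝔼-cong μ (λ y → 𝔼-map (y ∷_) (power μ k) H))

  power-dist : ∀ {μ} → Dist μ → ∀ k → Dist (power μ k)
  power-dist D zero = return-dist []
  power-dist {μ} D (suc k) = >>=-dist D λ y →
    map⁺ (proj₁ (power-dist D k)) , trans (𝔼-map (y ∷_) (power μ k) _) (proj₂ (power-dist D k))

  -- A product measure is unchanged when one coordinate is redrawn independently. Hence the input
  -- completed by the planted instance has the product law, whatever `i` is.
  𝔼-resample : ∀ {μ} → Dist μ → ∀ {k} (i : Fin k) H →
    𝔼 (power μ k) (λ X → 𝔼 μ (λ y → H (X [ i ]≔ y))) ≡ 𝔼 (power μ k) H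
  𝔼-resample {μ} D {suc k} zero H = begin
    𝔼 (power μ (suc k)) (λ X → 𝔼 μ (λ y → H (X [ zero ]≔ y)))        ≡⟨ 𝔼-power-suc μ k _ ⟩
    𝔼 μ (λ _ → 𝔼 (power μ k) (λ X → 𝔼 μ (λ y → H (y ∷ X))))          ≡⟨ 𝔼-const D _ ⟩
    𝔼 (power μ k) (λ X → 𝔼 μ (λ y → H (y ∷ X)))
      ≡⟨ 𝔼-swap (power μ k) μ (λ X y → H (y ∷ X)) ⟩
    𝔼 μ (λ y → 𝔼 (power μ k) (λ X → H (y ∷ X)))                      ≡⟨ 𝔼-power-suc μ k H ⟨
    𝔼 (power μ (suc k)) H                                            ∎ where open ≡-Reasoning
  𝔼-resample {μ} D {suc k} (suc i) H = begin
    𝔼 (power μ (suc k)) (λ X → 𝔼 μ (λ y → H (X [ suc i ]≔ y)))             ≡⟨ 𝔼-power-suc μ k _ ⟩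
    𝔼 μ (λ x → 𝔼 (power μ k) (λ X → 𝔼 μ (λ y → H (x ∷ X [ i ]≔ y))))
      ≡⟨ 𝔼-cong μ (λ x → 𝔼-resample D i (λ X → H (x ∷ X))) ⟩
    𝔼 μ (λ x → 𝔼 (power μ k) (λ X → H (x ∷ X)))                            ≡⟨ 𝔼-power-suc μ k H ⟨
    𝔼 (power μ (suc k)) H                                                  ∎ where open ≡-Reasoning

vectors : {Y : Set} → List Y → ∀ k → List (Vec Y k)
vectors ys zero = [] ∷ []
vectors ys (suc k) = cartesianProductWith _∷_ ys (vectors ys k)

∈-vectors : ∀ {Y : Set} {ys : List Y} → (∀ y → y ∈ ys) → ∀ {k} (X : Vec Y k) → X ∈ vectors ys k
∈-vectors complete [] = here refl
∈-vectors complete (y ∷ X) = ∈-cartesianProductWith⁺ _∷_ (complete y) (∈-vectors complete X)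

bools : List Bool
bools = false ∷ true ∷ []

∈-bools : ∀ b → b ∈ bools
∈-bools false = here refl
∈-bools true = there (here refl)

>>=-support : ∀ {X Y : Set} {Q : Y → Set} {A : W X} {f : X → W Y} →
  All (λ p → All (Q ∘ proj₂) (f (proj₂ p))) A → All (Q ∘ proj₂) (A >>= f)
>>=-support [] = []
>>=-support (q ∷ qs) = ++⁺ (map⁺ q) (>>=-support qs)

module _ {k n : ℕ} {O P : Set} where

  -- The i-th entry of X is drawn as well, but restrict never reads it.
  embed : ∀ w (A : RAlg (Fin k × Fin n) O) (h : Fin k → Vec (Vec Bool n) k → O → P) →
    W (Vec Bool n) → RAlg (Fin n) P
  embed w A h μ = A >>= λ t → unif w k >>= λ i → power μ k >>= λ X → return (restrict (h i X) i X t)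

  -- One computation for all three payoffs. `H` expresses the payoff `Φ` through the completed input
  -- alone; resampling makes the law of that input independent of `i`, so the average over `i` can
  -- be taken first, for a fixed input, and compared with a quantity `Z` of a run of `A`.
  𝔼-embed : ∀ {w} {A : RAlg (Fin k × Fin n) O} {h : Fin k → Vec (Vec Bool n) k → O → P} {μ} →
    NonNeg A → Dist μ →
    (Φ : DTree (Fin n) P → Vec Bool n → ℚ)
    (H : DTree (Fin k × Fin n) O → Fin k → Vec (Vec Bool n) k → ℚ)
    (Z : DTree (Fin k × Fin n) O → Vec (Vec Bool n) k → ℚ) →
    (∀ t i X y → Φ (restrict (h i X) i X t) y ≡ H t i (X [ i ]≔ y)) →
    ∀ {c z} → 0ℚ ≤ℚ c → (∀ t X → 𝔼 (unif w k) (λ i → H t i X) ≤ℚ c * Z t X) →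
    (∀ X → 𝔼 A (λ t → Z t X) ≤ℚ z) →
    𝔼 (embed w A h μ) (λ s → 𝔼 μ (Φ s)) ≤ℚ c * z
  𝔼-embed {w} {A} {h} {μ} nn D Φ H Z Φ≡H {c} {z} c≥0 avg bound = begin
    𝔼 (embed w A h μ) (λ s → 𝔼 μ (Φ s))
      ≡⟨ 𝔼->>= A _ _ ⟩
    𝔼 A (λ t → 𝔼 (unif w k >>= λ i → power μ k >>= λ X → return (restrict (h i X) i X t)) (λ s → 𝔼 μ (Φ s)))
      ≡⟨ 𝔼-cong A (λ t → trans (𝔼->>= (unif w k) _ _) (𝔼-cong (unif w k) (λ i → at t i))) ⟩
    𝔼 A (λ t → 𝔼 (unif w k) (λ i → 𝔼 (power μ k) (H t i)))
      ≡⟨ 𝔼-cong A (λ t → 𝔼-swap (unif w k) (power μ k) (H t)) ⟩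
    𝔼 A (λ t → 𝔼 (power μ k) (λ X → 𝔼 (unif w k) (λ i → H t i X)))
      ≤⟨ 𝔼-mono nn (λ t → 𝔼-mono (proj₁ (power-dist D k)) (avg t)) ⟩
    𝔼 A (λ t → 𝔼 (power μ k) (λ X → c * Z t X))
      ≡⟨ 𝔼-swap A (power μ k) _ ⟩
    𝔼 (power μ k) (λ X → 𝔼 A (λ t → c * Z t X))
      ≡⟨ 𝔼-cong (power μ k) (λ X → 𝔼-*ˡ A c _) ⟩
    𝔼 (power μ k) (λ X → c * 𝔼 A (λ t → Z t X))
      ≤⟨ 𝔼-≤ (power-dist D k) (λ X → *-monoˡ c≥0 (bound X)) ⟩
    c * z ∎
    where
    open ≤-Reasoning
    at : ∀ t i → 𝔼 (power μ k >>= λ X → return (restrict (h i X) i X t)) (λ s → 𝔼 μ (Φ s)) ≡ 𝔼 (power μ k) (H t i)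
    at t i = trans (𝔼->>= (power μ k) _ _)
      (trans (𝔼-cong (power μ k) (λ X → trans (𝔼-return (restrict (h i X) i X t) (λ s → 𝔼 μ (Φ s))) (𝔼-cong μ (Φ≡H t i X))))
             (𝔼-resample D i (H t i)))

  -- The minimax theorem needs one finite list of trees that contains every response, independently
  -- of `μ`.
  embed-support : ∀ {w} {A : RAlg (Fin k × Fin n) O} {h : Fin k → Vec (Vec Bool n) k → O → P} {μ} {Q : DTree (Fin n) P → Set} →
    (∀ {t} → t ∈ map proj₂ A → ∀ i X → Q (restrict (h i X) i X t)) → All (Q ∘ proj₂) (embed w A h μ)
  embed-support {w} {A} {h} {μ} {Q} hQ = >>=-support {A = A} (All.tabulate λ {p} p∈ →
    >>=-support {A = unif w k} (All.universal (λ q →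
      >>=-support {A = power μ k} (All.universal (λ X → hQ (∈-map⁺ proj₂ p∈) (proj₂ q) (proj₂ X) ∷ []) (power μ k))) (unif w k)))

-- Amplification

½^_ : ℕ → ℚ
½^ zero = 1ℚ
½^ suc m = ½ * ½^ m

0<½^ : ∀ m → 0ℚ < ½^ m
0<½^ zero = positive⁻¹ 1ℚ
0<½^ (suc m) = 0<-* (positive⁻¹ ½) (0<½^ m)

0≤½^ : ∀ m → 0ℚ ≤ℚ ½^ m
0≤½^ m = <⇒≤ (0<½^ m)

½^≤1 : ∀ m → ½^ m ≤ℚ 1ℚ
½^≤1 zero = ≤-refl
½^≤1 (suc m) = ≤-trans (*-monoˡ (nonNegative⁻¹ ½) (½^≤1 m)) (≤ᵇ⇒≤ _)

m*½^m≤1 : ∀ m → toℚ m * ½^ m ≤ℚ 1ℚ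
m*½^m≤1 zero = ≤ᵇ⇒≤ _
m*½^m≤1 (suc m) = begin
  toℚ (suc m) * (½ * ½^ m)             ≡⟨ cong (_* (½ * ½^ m)) (toℚ-+ 1 m) ⟩
  (1ℚ + toℚ m) * (½ * ½^ m)
    ≡⟨ solve 3 (λ h m p → (con 1ℚ :+ m) :* (h :* p) := h :* (p :+ m :* p)) refl ½ (toℚ m) (½^ m) ⟩
  ½ * (½^ m + toℚ m * ½^ m)            ≤⟨ *-monoˡ (nonNegative⁻¹ ½) (+-mono-≤ (½^≤1 m) (m*½^m≤1 m)) ⟩
  ½ * (1ℚ + 1ℚ)                        ≡⟨⟩
  1ℚ                                   ∎ where open ≤-Reasoning

≤-toℚ : ∀ p → ∃ λ m → p ≤ℚ toℚ m
≤-toℚ (mkℚ (ℤ.+ m) d _) = m , ≤-trans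
  (*≤* (ℤ.*-monoˡ-≤-nonNeg (ℤ.+ m) (ℤ.+≤+ (ℕ.s≤s ℕ.z≤n)))) (≤-reflexive (sym (toℚ-normal m)))
≤-toℚ (mkℚ ℤ.-[1+ m ] d _) = 0 , *≤* ℤ.-≤+

½^-small : ∀ n {r} → 0ℚ < r → ∃ λ m → toℚ n * ½^ m < r
½^-small n {r} 0<r with recip r 0<r
... | b , _ , rb≡1 with ≤-toℚ (toℚ n * b + 1ℚ)
-- With m at least n / r + 1 and m times `½^ m` at most 1, the difference r - n `½^ m` is at least r
-- `½^ m`; the summand 1 makes the inequality strict.
...   | m , bound = m , 0<-⇒< (<-≤-trans (0<-* 0<r (0<½^ m)) (begin
  r * ½^ m
    ≡⟨ solve 3 (λ r h x → r :* h := (r :* ((x :+ con 1ℚ) :* h)) :- r :* x :* h) refl r (½^ m) x ⟩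
  r * ((x + 1ℚ) * ½^ m) - r * x * ½^ m
    ≤⟨ +-monoˡ-≤ (- (r * x * ½^ m)) (*-monoˡ (<⇒≤ 0<r) (≤-trans (*-monoʳ (0≤½^ m) bound) (m*½^m≤1 m))) ⟩
  r * 1ℚ - r * x * ½^ m
    ≡⟨ cong₂ (λ p q → p - q * ½^ m) (*-identityʳ r) rx≡n ⟩
  r - toℚ n * ½^ m ∎))
  where
  open ≤-Reasoning
  x = toℚ n * b
  rx≡n : r * x ≡ toℚ n
  rx≡n = trans (solve 3 (λ r n b → r :* (n :* b) := n :* (r :* b)) refl r (toℚ n) b) (trans (cong (toℚ n *_) rb≡1) (*-identityʳ (toℚ n)))

full : ∀ {I O : Set} m → (Fin m → I) → (Vec Bool m → O) → DTree I O
full zero ι g = leaf (g [])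
full (suc m) ι g = node (ι zero) (full m (ι ∘ suc) (g ∘ (false ∷_))) (full m (ι ∘ suc) (g ∘ (true ∷_)))

module _ {I O : Set} where

  eval-full : ∀ m (ι : Fin m → I) (g : Vec Bool m → O) x → eval (full m ι g) x ≡ g (tabulate (x ∘ ι))
  eval-full zero ι g x = refl
  eval-full (suc m) ι g x with x (ι zero)
  ... | true = eval-full m (ι ∘ suc) (g ∘ (true ∷_)) x
  ... | false = eval-full m (ι ∘ suc) (g ∘ (false ∷_)) x

  queries-full : ∀ m (ι : Fin m → I) (g : Vec Bool m → O) x → queries (full m ι g) x ≡ m
  queries-full zero ι g x = refl
  queries-full (suc m) ι g x with x (ι zero)
  ... | true = cong suc (queries-full m (ι ∘ suc) (g ∘ (true ∷_)) x)
  ... | false = cong suc (queries-full m (ι ∘ suc) (g ∘ (false ∷_)) x)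

module _ {I O P : Set} where

  graft : DTree I O → (O → DTree I P) → DTree I P
  graft (leaf o) h = h o
  graft (node i t₀ t₁) h = node i (graft t₀ h) (graft t₁ h)

  eval-graft : ∀ t (h : O → DTree I P) x → eval (graft t h) x ≡ eval (h (eval t x)) x
  eval-graft (leaf o) h x = refl
  eval-graft (node i t₀ t₁) h x with x i
  ... | true = eval-graft t₁ h x
  ... | false = eval-graft t₀ h x

  queries-graft : ∀ t (h : O → DTree I P) x → queries (graft t h) x ≡ queries t x ℕ.+ queries (h (eval t x)) x
  queries-graft (leaf o) h x = refl
  queries-graft (node i t₀ t₁) h x with x i
  ... | true = cong suc (queries-graft t₁ h x)
  ... | false = cong suc (queries-graft t₀ h x)

failed : Bool → Maybe Bool → ℚ
failed v o = aborted o + wrong v o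

0≤failed : ∀ v o → 0ℚ ≤ℚ failed v o
0≤failed v o = 0≤-+ (0≤aborted o) (0≤wrong v o)

module _ {I : Set} where

  conclude : Maybe Bool → Maybe Bool → DTree I Bool → DTree I Bool
  conclude (just b) (just b′) t = if ⌊ b Bool.≟ b′ ⌋ then leaf b else t
  conclude _ _ t = t

  retry : DTree I (Maybe Bool) → DTree I (Maybe Bool) → DTree I Bool → DTree I Bool
  retry t₁ t₂ t₃ = graft t₁ λ o₁ → graft t₂ λ o₂ → conclude o₁ o₂ t₃

  -- The third tree runs only after an abort or a disagreement. Two different bits cannot both equal
  -- `v`, so in either case at least one of the two runs failed.
  conclude-cases : ∀ v o₁ o₂ →
    ((∀ t → conclude o₁ o₂ t ≡ t) × 1ℚ ≤ℚ failed v o₁ + failed v o₂) ⊎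
    (∃ λ b → o₁ ≡ just b × o₂ ≡ just b × ∀ t → conclude o₁ o₂ t ≡ leaf b)
  conclude-cases v nothing o₂ = inj₁ ((λ t → refl) , +-monoʳ-≤ 1ℚ (0≤failed v o₂))
  conclude-cases v (just b) nothing = inj₁ ((λ t → refl) , +-monoˡ-≤ 1ℚ (0≤failed v (just b)))
  conclude-cases v (just true) (just true) = inj₂ (true , refl , refl , λ t → refl)
  conclude-cases v (just false) (just false) = inj₂ (false , refl , refl , λ t → refl)
  conclude-cases true (just true) (just false) = inj₁ ((λ t → refl) , ≤ᵇ⇒≤ _)
  conclude-cases false (just true) (just false) = inj₁ ((λ t → refl) , ≤ᵇ⇒≤ _)
  conclude-cases true (just false) (just true) = inj₁ ((λ t → refl) , ≤ᵇ⇒≤ _)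
  conclude-cases false (just false) (just true) = inj₁ ((λ t → refl) , ≤ᵇ⇒≤ _)

  module _ (v : Bool) (x : I → Bool) where

    1≤⇒≤* : ∀ {p q} → 1ℚ ≤ℚ p → 0ℚ ≤ℚ q → q ≤ℚ p * q
    1≤⇒≤* {p} {q} 1≤p 0≤q = ≤-trans (≤-reflexive (sym (*-identityˡ q))) (*-monoʳ 0≤q 1≤p)

    -- The bound is affine in the cost of `t₃`, with coefficients depending only on the first two
    -- runs, so that independence factors the expectation. `miss-retry` has the same form for the
    -- same reason.
    queries-retry : ∀ t₁ t₂ t₃ → toℚ (queries (retry t₁ t₂ t₃) x) ≤ℚ
      (toℚ (queries t₁ x) + toℚ (queries t₂ x)) + (failed v (eval t₁ x) + failed v (eval t₂ x)) * toℚ (queries t₃ x)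
    queries-retry t₁ t₂ t₃ = begin
      toℚ (queries (retry t₁ t₂ t₃) x)
        ≡⟨ cong toℚ (trans (queries-graft t₁ _ x) (cong (queries t₁ x ℕ.+_) (queries-graft t₂ _ x))) ⟩
      toℚ (queries t₁ x ℕ.+ (queries t₂ x ℕ.+ queries (conclude o₁ o₂ t₃) x))
        ≡⟨ trans (toℚ-+ (queries t₁ x) _) (cong (toℚ (queries t₁ x) +_) (toℚ-+ (queries t₂ x) _)) ⟩
      toℚ (queries t₁ x) + (toℚ (queries t₂ x) + toℚ (queries (conclude o₁ o₂ t₃) x))
        ≡⟨ +-assoc (toℚ (queries t₁ x)) _ _ ⟨
      (toℚ (queries t₁ x) + toℚ (queries t₂ x)) + toℚ (queries (conclude o₁ o₂ t₃) x)
        ≤⟨ +-monoʳ-≤ (toℚ (queries t₁ x) + toℚ (queries t₂ x)) last ⟩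
      (toℚ (queries t₁ x) + toℚ (queries t₂ x)) + (failed v o₁ + failed v o₂) * toℚ (queries t₃ x) ∎
      where
      open ≤-Reasoning
      o₁ = eval t₁ x
      o₂ = eval t₂ x
      last : toℚ (queries (conclude o₁ o₂ t₃) x) ≤ℚ (failed v o₁ + failed v o₂) * toℚ (queries t₃ x)
      last with conclude-cases v o₁ o₂
      ... | inj₁ (same , 1≤) rewrite same t₃ = 1≤⇒≤* 1≤ (0≤toℚ (queries t₃ x))
      ... | inj₂ (b , _ , _ , agree) rewrite agree t₃ = 0≤-* (0≤-+ (0≤failed v o₁) (0≤failed v o₂)) (0≤toℚ (queries t₃ x))

    miss-retry : ∀ t₁ t₂ t₃ → miss v (eval (retry t₁ t₂ t₃) x) ≤ℚ
      wrong v (eval t₁ x) * wrong v (eval t₂ x) + (failed v (eval t₁ x) + failed v (eval t₂ x)) * miss v (eval t₃ x)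
    miss-retry t₁ t₂ t₃ rewrite eval-graft t₁ (λ o₁ → graft t₂ λ o₂ → conclude o₁ o₂ t₃) x
      | eval-graft t₂ (λ o₂ → conclude (eval t₁ x) o₂ t₃) x
      with conclude-cases v (eval t₁ x) (eval t₂ x)
    ... | inj₁ (same , 1≤) rewrite same t₃ = ≤-trans (≤-reflexive (sym (+-identityˡ _)))
          (+-mono-≤ (0≤-* (0≤wrong v (eval t₁ x)) (0≤wrong v (eval t₂ x))) (1≤⇒≤* 1≤ (0≤wrong v (just (eval t₃ x)))))
    -- An accepted answer is wrong only if both runs gave it, and a 0/1 value equals its square; the
    -- product later yields the squared error probability.
    ... | inj₂ (b , e₁ , e₂ , agree) rewrite agree t₃ | e₁ | e₂ = ≤-trans (≤-reflexive (trans (miss-idem v b) (sym (+-identityʳ _))))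
          (+-monoʳ-≤ (miss v b * miss v b) (0≤-* (0≤-+ (0≤failed v (just b)) (0≤failed v (just b))) (0≤wrong v (just (eval t₃ x)))))
      where
      miss-idem : ∀ v b → miss v b ≡ miss v b * miss v b
      miss-idem true true = refl
      miss-idem true false = refl
      miss-idem false true = refl
      miss-idem false false = refl

𝔼-affine : ∀ {X : Set} {A : W X} → Dist A → ∀ p c F → 𝔼 A (λ x → p + c * F x) ≡ p + c * 𝔼 A F
𝔼-affine {A = A} D p c F = trans (𝔼-+ A (λ _ → p) (λ x → c * F x)) (cong₂ _+_ (𝔼-const D p) (𝔼-*ˡ A c F))

module _ {X Z : Set} {M : W X} {B : W Z} (M-dist : Dist M) (B-dist : Dist B) where

  thrice : {Y : Set} → (X → X → Z → Y) → W Y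
  thrice g = M >>= λ x₁ → M >>= λ x₂ → B >>= λ z → return (g x₁ x₂ z)

  thrice-dist : {Y : Set} (g : X → X → Z → Y) → Dist (thrice g)
  thrice-dist g = >>=-dist M-dist λ x₁ → >>=-dist M-dist λ x₂ → >>=-dist B-dist λ z → return-dist _

  𝔼-thrice : {Y : Set} (g : X → X → Z → Y) (Φ : Y → ℚ) (S : X → X → ℚ) (φ : X → ℚ) (G : Z → ℚ) →
    (∀ x₁ x₂ z → Φ (g x₁ x₂ z) ≤ℚ S x₁ x₂ + (φ x₁ + φ x₂) * G z) →
    𝔼 (thrice g) Φ ≤ℚ 𝔼 M (λ x₁ → 𝔼 M (S x₁)) + (𝔼 M φ + 𝔼 M φ) * 𝔼 B G
  𝔼-thrice g Φ S φ G h = begin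
    𝔼 (thrice g) Φ
      ≡⟨ trans (𝔼->>= M _ Φ) (𝔼-cong M λ x₁ → trans (𝔼->>= M _ Φ) (𝔼-cong M λ x₂ →
           trans (𝔼->>= B _ Φ) (𝔼-cong B λ z → 𝔼-return (g x₁ x₂ z) Φ))) ⟩
    𝔼 M (λ x₁ → 𝔼 M (λ x₂ → 𝔼 B (λ z → Φ (g x₁ x₂ z))))
      ≤⟨ 𝔼-mono M≥0 (λ x₁ → 𝔼-mono M≥0 (λ x₂ → 𝔼-mono (proj₁ B-dist) (h x₁ x₂))) ⟩
    𝔼 M (λ x₁ → 𝔼 M (λ x₂ → 𝔼 B (λ z → S x₁ x₂ + (φ x₁ + φ x₂) * G z)))
      ≡⟨ 𝔼-cong M (λ x₁ → 𝔼-cong M (λ x₂ → 𝔼-affine B-dist (S x₁ x₂) (φ x₁ + φ x₂) G)) ⟩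
    𝔼 M (λ x₁ → 𝔼 M (λ x₂ → S x₁ x₂ + (φ x₁ + φ x₂) * 𝔼 B G))
      ≡⟨ 𝔼-cong M (λ x₁ → trans (𝔼-+ M (S x₁) _) (cong (𝔼 M (S x₁) +_)
           (trans (𝔼-*ʳ M (𝔼 B G) _) (cong (_* 𝔼 B G) (trans (𝔼-+ M (λ _ → φ x₁) φ) (cong (_+ 𝔼 M φ) (𝔼-const M-dist (φ x₁)))))))) ⟩
    𝔼 M (λ x₁ → 𝔼 M (S x₁) + (φ x₁ + 𝔼 M φ) * 𝔼 B G)
      ≡⟨ trans (𝔼-+ M (λ x₁ → 𝔼 M (S x₁)) _) (cong (𝔼 M (λ x₁ → 𝔼 M (S x₁)) +_)
           (trans (𝔼-*ʳ M (𝔼 B G) _) (cong (_* 𝔼 B G) (trans (𝔼-+ M φ (λ _ → 𝔼 M φ)) (cong (𝔼 M φ +_) (𝔼-const M-dist (𝔼 M φ))))))) ⟩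
    𝔼 M (λ x₁ → 𝔼 M (S x₁)) + (𝔼 M φ + 𝔼 M φ) * 𝔼 B G ∎
    where
    open ≤-Reasoning
    M≥0 = proj₁ M-dist

module Amplify {n : ℕ} (F : Vec Bool n → Bool) {M : RAlg (Fin n) (Maybe Bool)} (M-dist : Dist M)
  {a e : ℚ}
  (cost : ∀ y → 𝔼 M (λ t → toℚ (queries t (lookup y))) ≤ℚ a)
  (err : ∀ y → 𝔼 M (λ t → wrong (F y) (eval t (lookup y))) * 𝔼 M (λ t → wrong (F y) (eval t (lookup y))) ≤ℚ ½ * e)
  (fail : ∀ y → 𝔼 M (λ t → failed (F y) (eval t (lookup y))) + 𝔼 M (λ t → failed (F y) (eval t (lookup y))) ≤ℚ ½)
  (0≤e : 0ℚ ≤ℚ e)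
  where

  -- At most `m` double runs are made, and after the last failure the whole input is read, without
  -- error.
  amplified : (m : ℕ) → ∃ λ (B : RAlg (Fin n) Bool) → Dist B
  amplified zero = return (full n id F) , return-dist _
  amplified (suc m) = thrice M-dist (proj₂ (amplified m)) retry , thrice-dist M-dist (proj₂ (amplified m)) retry

  -- A round costs 2a and continues with probability at most 1/2; 4a is the fixed point of x = 2a +
  -- x / 2, and the cost n of the full reading is halved in each round.
  amplified-cost : ∀ m y → 𝔼 (proj₁ (amplified m)) (λ t → toℚ (queries t (lookup y))) ≤ℚ (a + a) + (a + a) + toℚ n * ½^ m
  amplified-cost zero y = begin
    𝔼 (return (full n id F)) (λ t → toℚ (queries t (lookup y)))
      ≡⟨ 𝔼-return (full n id F) (λ t → toℚ (queries t (lookup y))) ⟩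
    toℚ (queries (full n id F) (lookup y))
      ≡⟨ cong toℚ (queries-full n id F (lookup y)) ⟩
    toℚ n
      ≡⟨ solve 1 (λ n → n := con 0ℚ :+ n :* con 1ℚ) refl (toℚ n) ⟩
    0ℚ + toℚ n * 1ℚ
      ≤⟨ +-monoˡ-≤ (toℚ n * 1ℚ) (0≤-+ (0≤-+ 0≤a 0≤a) (0≤-+ 0≤a 0≤a)) ⟩
    (a + a) + (a + a) + toℚ n * 1ℚ                                ∎
    where
    open ≤-Reasoning
    0≤a : 0ℚ ≤ℚ a
    0≤a = ≤-trans (0≤-𝔼 (proj₁ M-dist) (λ t → 0≤toℚ (queries t (lookup y)))) (cost y)
  amplified-cost (suc m) y = begin
    𝔼 (proj₁ (amplified (suc m))) Q
      ≤⟨ 𝔼-thrice M-dist B-dist retry Q (λ t₁ t₂ → Qᴹ t₁ + Qᴹ t₂) φ Q (queries-retry (F y) (lookup y)) ⟩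
    𝔼 M (λ t₁ → 𝔼 M (λ t₂ → Qᴹ t₁ + Qᴹ t₂)) + (𝔼 M φ + 𝔼 M φ) * 𝔼 B Q
      ≡⟨ cong (_+ (𝔼 M φ + 𝔼 M φ) * 𝔼 B Q) (trans (𝔼-cong M (λ t₁ → trans (𝔼-+ M (λ _ → Qᴹ t₁) Qᴹ) (cong (_+ 𝔼 M Qᴹ) (𝔼-const M-dist (Qᴹ t₁)))))
           (trans (𝔼-+ M Qᴹ (λ _ → 𝔼 M Qᴹ)) (cong (𝔼 M Qᴹ +_) (𝔼-const M-dist (𝔼 M Qᴹ))))) ⟩
    (𝔼 M Qᴹ + 𝔼 M Qᴹ) + (𝔼 M φ + 𝔼 M φ) * 𝔼 B Q
      ≤⟨ +-mono-≤ (+-mono-≤ (cost y) (cost y)) (≤-trans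
           (*-monoʳ (0≤-𝔼 (proj₁ B-dist) (λ t → 0≤toℚ (queries t (lookup y)))) (fail y))
           (*-monoˡ (nonNegative⁻¹ ½) (amplified-cost m y))) ⟩
    (a + a) + ½ * ((a + a) + (a + a) + toℚ n * ½^ m)
      ≡⟨ solve 3 (λ a n h → (a :+ a) :+ con ½ :* ((a :+ a) :+ (a :+ a) :+ n :* h) :=
                          (a :+ a) :+ (a :+ a) :+ n :* (con ½ :* h)) refl a (toℚ n) (½^ m) ⟩
    (a + a) + (a + a) + toℚ n * ½^ suc m ∎
    where
    open ≤-Reasoning
    B = proj₁ (amplified m)
    B-dist = proj₂ (amplified m)
    φ : DTree (Fin n) (Maybe Bool) → ℚ
    φ t = failed (F y) (eval t (lookup y))
    Q : DTree (Fin n) Bool → ℚ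
    Q t = toℚ (queries t (lookup y))
    Qᴹ : DTree (Fin n) (Maybe Bool) → ℚ
    Qᴹ t = toℚ (queries t (lookup y))

  -- The error `e` is kept invariant: half of it pays for two equal wrong answers, and the other
  -- half for the continuation, reached with probability at most 1/2.
  amplified-err : ∀ m y → 𝔼 (proj₁ (amplified m)) (λ t → miss (F y) (eval t (lookup y))) ≤ℚ e
  amplified-err zero y = ≤-trans (≤-reflexive (begin
    𝔼 (return (full n id F)) (λ t → miss (F y) (eval t (lookup y)))
      ≡⟨ 𝔼-return (full n id F) (λ t → miss (F y) (eval t (lookup y))) ⟩
    miss (F y) (eval (full n id F) (lookup y))
      ≡⟨ cong (miss (F y)) (trans (eval-full n id F (lookup y)) (cong F (tabulate∘lookup y))) ⟩
    miss (F y) (F y)                                                  ≡⟨ miss-refl (F y) ⟩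
    0ℚ                                                                ∎)) 0≤e
    where open ≡-Reasoning
  amplified-err (suc m) y = begin
    𝔼 (proj₁ (amplified (suc m))) miss-at
      ≤⟨ 𝔼-thrice M-dist B-dist retry miss-at (λ t₁ t₂ → ω t₁ * ω t₂) φ miss-at (miss-retry (F y) (lookup y)) ⟩
    𝔼 M (λ t₁ → 𝔼 M (λ t₂ → ω t₁ * ω t₂)) + (𝔼 M φ + 𝔼 M φ) * 𝔼 B miss-at
      ≡⟨ cong (_+ (𝔼 M φ + 𝔼 M φ) * 𝔼 B miss-at) (trans (𝔼-cong M (λ t₁ → 𝔼-*ˡ M (ω t₁) ω)) (𝔼-*ʳ M (𝔼 M ω) ω)) ⟩
    𝔼 M ω * 𝔼 M ω + (𝔼 M φ + 𝔼 M φ) * 𝔼 B miss-at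
      ≤⟨ +-mono-≤ (err y) (≤-trans
           (*-monoʳ (0≤-𝔼 (proj₁ B-dist) (λ t → 0≤wrong (F y) (just (eval t (lookup y))))) (fail y))
           (*-monoˡ (nonNegative⁻¹ ½) (amplified-err m y))) ⟩
    ½ * e + ½ * e
      ≡⟨ solve 1 (λ e → con ½ :* e :+ con ½ :* e := e) refl e ⟩
    e ∎
    where
    open ≤-Reasoning
    B = proj₁ (amplified m)
    B-dist = proj₂ (amplified m)
    miss-at : DTree (Fin n) Bool → ℚ
    miss-at t = miss (F y) (eval t (lookup y))
    ω : DTree (Fin n) (Maybe Bool) → ℚ
    ω t = wrong (F y) (eval t (lookup y))
    φ : DTree (Fin n) (Maybe Bool) → ℚ
    φ t = failed (F y) (eval t (lookup y))

-- Strong direct sum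

1/suc-inverse : ∀ m → toℚ (suc m) * (ℤ.+ 1 / suc m) ≡ 1ℚ
1/suc-inverse m = begin
  toℚ (suc m) * (ℤ.+ 1 / suc m)
    ≡⟨ cong₂ _*_ (toℚ-normal (suc m)) (normalize-coprime (1-coprimeTo (suc m))) ⟩
  q * 1/ q                        ≡⟨ *-inverseʳ q ⟩
  1ℚ                              ∎
  where
  open ≡-Reasoning
  q = mkℚ (ℤ.+ suc m) 0 (coprime-sym (1-coprimeTo (suc m)))

1/suc-positive : ∀ m → 0ℚ < ℤ.+ 1 / suc m
1/suc-positive m = positive⁻¹ _ {{normalize-pos 1 (suc m)}}

1/suc≤½ : ∀ m → ℤ.+ 1 / suc (suc m) ≤ℚ ½
-- Since (m + 2) κ = 1, the difference ½ - κ equals ½ m κ.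
1/suc≤½ m = 0≤-⇒≤ (subst (0ℚ ≤ℚ_) eq (0≤-* (nonNegative⁻¹ ½) (0≤-* (0≤toℚ m) (<⇒≤ (1/suc-positive (suc m))))))
  where
  open ≡-Reasoning
  κ = ℤ.+ 1 / suc (suc m)
  eq : ½ * (toℚ m * κ) ≡ ½ - κ
  eq = begin
    ½ * (toℚ m * κ)
      ≡⟨ solve 2 (λ m κ → con ½ :* (m :* κ) := con ½ :* ((con 1ℚ :+ (con 1ℚ :+ m)) :* κ) :- κ) refl (toℚ m) κ ⟩
    ½ * ((1ℚ + (1ℚ + toℚ m)) * κ) - κ
      ≡⟨ cong (λ z → ½ * (z * κ) - κ) (trans (toℚ-+ 1 (suc m)) (cong (1ℚ +_) (toℚ-+ 1 m))) ⟨
    ½ * (toℚ (suc (suc m)) * κ) - κ                  ≡⟨ cong (λ z → ½ * z - κ) (1/suc-inverse (suc m)) ⟩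
    ½ * 1ℚ - κ                                       ≡⟨⟩
    ½ - κ                                            ∎

module _ {n : ℕ} (f : BoolFun n) {k : ℕ} {ε : ℚ} (ε≤ : ε ≤ℚ ℤ.+ 1 / 20)
  (A : RAlg (Fin (suc k) × Fin n) (Vec Bool (suc k)))
  (computes : Computes (≡-dec Bool._≟_) A (directSum f (suc k)) ε) where

  computed-dist : Dist A
  computed-dist = proj₁ (proj₁ computes) , trans (sym (totalWeight≡𝔼 A)) (proj₂ (proj₁ computes))

  -- Without function extensionality f could separate pointwise equal inputs, but the trees cannot.
  computed-extensional : ∀ {y y′} → y ≗ y′ → f y ≡ f y′
  computed-extensional {y} {y′} y≗y′ with f y Bool.≟ f y′
  ... | yes fy≡fy′ = fy≡fy′
  ... | no fy≢fy′ = contradiction (0<-⇒< (positive⁻¹ (1ℚ - (ℤ.+ 1 / 20 + ℤ.+ 1 / 20)))) (≤⇒≯ (begin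
      1ℚ                                   ≡⟨ 𝔼-const computed-dist 1ℚ ⟨
      𝔼 A (λ _ → 1ℚ)                       ≤⟨ 𝔼-mono (proj₁ computed-dist) pointwise ⟩
      𝔼 A (λ t → bad y t + bad y′ t)       ≡⟨ 𝔼-+ A (bad y) (bad y′) ⟩
      𝔼 A (bad y) + 𝔼 A (bad y′)           ≤⟨ +-mono-≤ (bad≤ y) (bad≤ y′) ⟩
      ℤ.+ 1 / 20 + ℤ.+ 1 / 20              ∎))
    where
    open ≤-Reasoning
    rows : (Fin n → Bool) → Fin (suc k) × Fin n → Bool
    rows y (_ , j) = y j
    bad : (Fin n → Bool) → DTree (Fin (suc k) × Fin n) (Vec Bool (suc k)) → ℚ
    bad y t = mismatch _≟ᵛ_ (directSum f (suc k) (rows y)) (eval t (rows y))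
    bad≤ : ∀ y → 𝔼 A (bad y) ≤ℚ ℤ.+ 1 / 20
    bad≤ y = ≤-trans (≤-trans (≤-reflexive (sym (errProb≡𝔼 _≟ᵛ_ A (rows y) _))) (proj₂ computes (rows y))) ε≤
    -- A tree gives the same output on both inputs, but the correct outputs differ in their first
    -- entry, so it errs on one of them. The two error probabilities then sum to at least 1, against
    -- the bound 1/10.
    pointwise : ∀ t → 1ℚ ≤ℚ bad y t + bad y′ t
    pointwise t rewrite eval-cong t {rows y} {rows y′} (λ (_ , j) → y≗y′ j)
      with eval t (rows y′) ≟ᵛ directSum f (suc k) (rows y) | eval t (rows y′) ≟ᵛ directSum f (suc k) (rows y′)
    ... | yes e | yes e′ = contradiction (cong Vec.head (trans (sym e) e′)) fy≢fy′
    ... | yes _ | no _ = ≤-refl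
    ... | no _ | yes _ = ≤-refl
    ... | no _ | no _ = ≤ᵇ⇒≤ _

module Embedding {n k : ℕ} (F : Vec Bool n → Bool) {κ : ℚ} (0<κ : 0ℚ < κ) (kκ≡1 : toℚ k * κ ≡ 1ℚ)
  (A : RAlg (Fin k × Fin n) (Vec Bool k)) (A-dist : Dist A) {ε q : ℚ}
  (cost≤ : ∀ X → 𝔼 A (λ t → toℚ (queries t (entries X))) ≤ℚ q)
  (err≤ : ∀ X → 𝔼 A (λ t → mismatch _≟ᵛ_ (Vec.map F X) (eval t (entries X))) ≤ℚ ε) where

  payoff : Fin 3 → DTree (Fin n) (Maybe Bool) → Vec Bool n → ℚ
  payoff 0F s y = toℚ (queries s (lookup y))
  payoff 1F s y = aborted (eval s (lookup y))
  payoff 2F s y = wrong (F y) (eval s (lookup y))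

  0≤payoff : ∀ i s y → 0ℚ ≤ℚ payoff i s y
  0≤payoff 0F s y = 0≤toℚ (queries s (lookup y))
  0≤payoff 1F s y = 0≤aborted (eval s (lookup y))
  0≤payoff 2F s y = 0≤wrong (F y) (eval s (lookup y))

  limit : Fin 3 → ℚ
  limit 0F = κ * q
  limit 1F = ε
  limit 2F = κ * ε

  labelled : Fin k → Vec (Vec Bool n) k → Vec Bool k → Maybe Bool
  labelled i X = label i (Vec.map F X)

  embedded : W (Vec Bool n) → RAlg (Fin n) (Maybe Bool)
  embedded = embed κ A labelled

  restrict-label : ∀ t i X y → eval (restrict (labelled i X) i X t) (lookup y) ≡
    label i (Vec.map F (X [ i ]≔ y)) (eval t (entries (X [ i ]≔ y)))
  restrict-label t i X y = begin
    eval (restrict (labelled i X) i X t) (lookup y)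
      ≡⟨ eval-restrict (labelled i X) i X t y ⟩
    label i (Vec.map F X) (eval t (entries (X [ i ]≔ y)))
      ≡⟨ label-[]≔ i (Vec.map F X) (F y) _ ⟨
    label i (Vec.map F X [ i ]≔ F y) (eval t (entries (X [ i ]≔ y)))
      ≡⟨ cong (λ as → label i as (eval t (entries (X [ i ]≔ y)))) (map-[]≔ F X i) ⟨
    label i (Vec.map F (X [ i ]≔ y)) (eval t (entries (X [ i ]≔ y)))             ∎ where open ≡-Reasoning

  -- Averaging over the planted coordinate gains the factor `κ` for queries and for wrong answers.
  -- It gains nothing for aborts: a single wrong output aborts the run at every later coordinate.
  embedded-payoff : ∀ {μ} → Dist μ → ∀ i → 𝔼 (embedded μ) (λ s → 𝔼 μ (payoff i s)) ≤ℚ limit i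
  embedded-payoff D 0F = 𝔼-embed (proj₁ A-dist) D (payoff 0F)
    (λ t i X → toℚ (queriesTo i t (entries X))) (λ t X → toℚ (queries t (entries X)))
    (λ t i X y → cong toℚ (queries-restrict (labelled i X) i X t y))
    (<⇒≤ 0<κ) (λ t X → ≤-reflexive (𝔼-queriesTo κ t (entries X))) cost≤
  embedded-payoff D 1F = ≤-trans (𝔼-embed (proj₁ A-dist) D (payoff 1F)
    (λ t i X → aborted (label i (Vec.map F X) (eval t (entries X))))
    (λ t X → mismatch _≟ᵛ_ (Vec.map F X) (eval t (entries X)))
    (λ t i X y → cong aborted (restrict-label t i X y))
    0≤1 (λ t X → ≤-trans (𝔼-≤ (unif-dist k (<⇒≤ 0<κ) kκ≡1) (λ i → aborted-label i (Vec.map F X) (eval t (entries X))))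
                         (≤-reflexive (sym (*-identityˡ _)))) err≤) (≤-reflexive (*-identityˡ ε))
  embedded-payoff D 2F = 𝔼-embed (proj₁ A-dist) D (payoff 2F)
    (λ t i X → wrong (lookup (Vec.map F X) i) (label i (Vec.map F X) (eval t (entries X))))
    (λ t X → mismatch _≟ᵛ_ (Vec.map F X) (eval t (entries X)))
    (λ t i X y → cong₂ wrong (sym (trans (cong (λ as → lookup as i) (map-[]≔ F X i)) (lookup∘update i (Vec.map F X) (F y))))
                           (restrict-label t i X y))
    (<⇒≤ 0<κ) (λ t X → wrong-label k (<⇒≤ 0<κ) (Vec.map F X) (eval t (entries X))) err≤

  inputs : List (Vec Bool n)
  inputs = vectors bools n

  trees : List (DTree (Fin n) (Maybe Bool))
  trees = cartesianProductWith (λ t (i , X) → restrict (labelled i X) i X t) (map proj₂ A)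
    (List.cartesianProduct (List.allFin k) (vectors inputs k))

  ⅓ : ℚ
  ⅓ = ℤ.+ 1 / 3

  worst-case : (bound : Fin 3 → ℚ) → (∀ i → limit i ≤ℚ ⅓ * bound i) →
    ∃ λ M → Dist M × ∀ i y → 𝔼 M (λ s → payoff i s y) ≤ℚ bound i
  -- One third, because there are three payoffs to be balanced.
  worst-case bound limit≤ = simultaneous-minimax payoff 0≤payoff bound ⅓ (positive⁻¹ ⅓) refl
    trees inputs (∈-vectors ∈-bools) (Vec.replicate n false)
    λ μ D → embedded μ ,
      >>=-dist A-dist (λ t → >>=-dist (unif-dist k (<⇒≤ 0<κ) kκ≡1) λ i → >>=-dist (power-dist D k) λ X → return-dist _) ,
      embed-support {w = κ} {A = A} {h = labelled} {μ = μ} (λ t∈ i X →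
        ∈-cartesianProductWith⁺ (λ t (i , X) → restrict (labelled i X) i X t) t∈
        (∈-cartesianProductWith⁺ _,_ (∈-allFin i) (∈-vectors (∈-vectors ∈-bools) X))) ,
      λ i → ≤-trans (embedded-payoff D i) (limit≤ i)

module Assembly {n : ℕ} (f : BoolFun n) (m : ℕ) {ε r : ℚ} (0≤ε : 0ℚ ≤ℚ ε) (ε≤ : ε ≤ℚ ℤ.+ 1 / 20)
  (A : RAlg (Fin (suc (suc m)) × Fin n) (Vec Bool (suc (suc m))))
  (computes : Computes (≡-dec Bool._≟_) A (directSum f (suc (suc m))) ε)
  (0<r : 0ℚ < r)
  (cheap : ∀ X → expQueries A (entries X) ≤ℚ ℤ.+ 1 / 24 * (toℚ (suc (suc m)) * r)) where

  k : ℕ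
  k = suc (suc m)

  F : Vec Bool n → Bool
  F = f ∘ lookup

  κ e : ℚ
  κ = ℤ.+ 1 / k
  e = ε * κ

  0≤e : 0ℚ ≤ℚ e
  0≤e = 0≤-* 0≤ε (<⇒≤ (1/suc-positive (suc m)))

  e≤ : e ≤ℚ ℤ.+ 1 / 40
  e≤ = ≤-trans (*-monoʳ (<⇒≤ (1/suc-positive (suc m))) ε≤) (*-monoˡ (nonNegative⁻¹ (ℤ.+ 1 / 20)) (1/suc≤½ m))

  directSum≡map : ∀ X → directSum f k (entries X) ≡ Vec.map F X
  directSum≡map X = trans (tabulate-∘ F (lookup X)) (cong (Vec.map F) (tabulate∘lookup X))

  open Embedding F (1/suc-positive (suc m)) (1/suc-inverse (suc m)) A (computed-dist f ε≤ A computes)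
    (λ X → ≤-trans (≤-reflexive (sym (expQueries≡𝔼 A (entries X)))) (cheap X))
    (λ X → ≤-trans (≤-reflexive (trans (cong (λ as → 𝔼 A (λ t → mismatch _≟ᵛ_ as (eval t (entries X)))) (sym (directSum≡map X)))
                                       (sym (errProb≡𝔼 _≟ᵛ_ A (entries X) _))))
                   (proj₂ computes (entries X)))

  -- Three times each limit. Amplification costs four times `bound 0F`, that is r / 2, and leaves r
  -- / 2 for the full reading; hence the constant 1/24 = 1/3 times 1/8.
  bound : Fin 3 → ℚ
  bound 0F = r * (ℤ.+ 1 / 8)
  bound 1F = ℤ.+ 3 / 20
  bound 2F = ℤ.+ 3 / 1 * e

  limit≤bound : ∀ i → limit i ≤ℚ ⅓ * bound i
  limit≤bound 0F = ≤-reflexive (begin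
    κ * (ℤ.+ 1 / 24 * (toℚ k * r))
      ≡⟨ solve 3 (λ κ K r → κ :* (con (ℤ.+ 1 / 24) :* (K :* r)) := con (ℤ.+ 1 / 24) :* (K :* κ) :* r) refl κ (toℚ k) r ⟩
    ℤ.+ 1 / 24 * (toℚ k * κ) * r         ≡⟨ cong (λ z → ℤ.+ 1 / 24 * z * r) (1/suc-inverse (suc m)) ⟩
    ℤ.+ 1 / 24 * 1ℚ * r
      ≡⟨ solve 1 (λ r → con (ℤ.+ 1 / 24) :* con 1ℚ :* r := con (ℤ.+ 1 / 3) :* (r :* con (ℤ.+ 1 / 8))) refl r ⟩
    ⅓ * (r * (ℤ.+ 1 / 8))                ∎) where open ≡-Reasoning
  limit≤bound 1F = ε≤
  limit≤bound 2F = ≤-reflexive (solve 2 (λ κ ε → κ :* ε := con (ℤ.+ 1 / 3) :* (con (ℤ.+ 3 / 1) :* (ε :* κ))) refl κ ε)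

  M : RAlg (Fin n) (Maybe Bool)
  M = proj₁ (worst-case bound limit≤bound)

  M-dist : Dist M
  M-dist = proj₁ (proj₂ (worst-case bound limit≤bound))

  M-payoff : ∀ i y → 𝔼 M (λ s → payoff i s y) ≤ℚ bound i
  M-payoff = proj₂ (proj₂ (worst-case bound limit≤bound))

  -- The square of 3e is 9e times e, and e ≤ 1/40 makes 9e at most 9/40. Here k ≥ 2 enters, through
  -- κ ≤ 1/2.
  M-wrong² : ∀ y → 𝔼 M (λ s → payoff 2F s y) * 𝔼 M (λ s → payoff 2F s y) ≤ℚ ½ * e
  M-wrong² y = begin
    p * p
      ≤⟨ *-monoˡ (0≤-𝔼 (proj₁ M-dist) (λ s → 0≤payoff 2F s y)) (M-payoff 2F y) ⟩
    p * (ℤ.+ 3 / 1 * e)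
      ≤⟨ *-monoʳ (0≤-* (nonNegative⁻¹ (ℤ.+ 3 / 1)) 0≤e) (≤-trans (M-payoff 2F y) (*-monoˡ (nonNegative⁻¹ (ℤ.+ 3 / 1)) e≤)) ⟩
    ℤ.+ 3 / 1 * (ℤ.+ 1 / 40) * (ℤ.+ 3 / 1 * e)   ≡⟨ *-assoc (ℤ.+ 3 / 1 * (ℤ.+ 1 / 40)) (ℤ.+ 3 / 1) e ⟨
    ℤ.+ 9 / 40 * e                               ≤⟨ *-monoʳ 0≤e (≤ᵇ⇒≤ {ℤ.+ 9 / 40} {½} _) ⟩
    ½ * e                                        ∎
    where
    open ≤-Reasoning
    p = 𝔼 M (λ s → payoff 2F s y)

  -- 3/20 + 3/40 = 9/40, so a union bound over two runs stays below 1/2.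
  M-failed : ∀ y → 𝔼 M (λ s → failed (F y) (eval s (lookup y))) ≤ℚ ℤ.+ 1 / 4
  M-failed y = begin
    𝔼 M (λ s → failed (F y) (eval s (lookup y)))                ≡⟨ 𝔼-+ M _ _ ⟩
    𝔼 M (λ s → payoff 1F s y) + 𝔼 M (λ s → payoff 2F s y)
      ≤⟨ +-mono-≤ (M-payoff 1F y) (≤-trans (M-payoff 2F y) (*-monoˡ (nonNegative⁻¹ (ℤ.+ 3 / 1)) e≤)) ⟩
    ℤ.+ 3 / 20 + ℤ.+ 3 / 1 * (ℤ.+ 1 / 40)                       ≤⟨ ≤ᵇ⇒≤ _ ⟩
    ℤ.+ 1 / 4                                                   ∎ where open ≤-Reasoning

  open Amplify F M-dist (M-payoff 0F) M-wrong² (λ y → +-mono-≤ (M-failed y) (M-failed y)) 0≤e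

  rounds : ∃ λ N → toℚ n * ½^ N < ½ * r
  rounds = ½^-small n (0<-* (positive⁻¹ ½) 0<r)

  B : RAlg (Fin n) Bool
  B = proj₁ (amplified (proj₁ rounds))

  B-dist : Dist B
  B-dist = proj₂ (amplified (proj₁ rounds))

  B-cost : ∀ y → expQueries B y < r
  B-cost y = begin-strict
    expQueries B y                                    ≡⟨ expQueries≡𝔼 B y ⟩
    𝔼 B (λ t → toℚ (queries t y))
      ≡⟨ 𝔼-cong B (λ t → cong toℚ (queries-cong t (λ i → sym (lookup∘tabulate y i)))) ⟩
    𝔼 B (λ t → toℚ (queries t (lookup (tabulate y)))) ≤⟨ amplified-cost (proj₁ rounds) (tabulate y) ⟩
    (a + a) + (a + a) + toℚ n * ½^ (proj₁ rounds)     <⟨ +-monoʳ-< ((a + a) + (a + a)) (proj₂ rounds) ⟩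
    (a + a) + (a + a) + ½ * r
      ≡⟨ solve 1 (λ r → (r :* c :+ r :* c) :+ (r :* c :+ r :* c) :+ con ½ :* r := r) refl r ⟩
    r                                                 ∎
    where
    open ≤-Reasoning
    a = bound 0F
    c : ∀ {n} → Polynomial n
    c = con (ℤ.+ 1 / 8)

  B-computes : Computes Bool._≟_ B f e
  B-computes = (proj₁ B-dist , trans (totalWeight≡𝔼 B) (proj₂ B-dist)) , λ y → begin
    errProb Bool._≟_ B y (f y)                                          ≡⟨ errProb≡𝔼 Bool._≟_ B y (f y) ⟩
    𝔼 B (λ t → miss (f y) (eval t y))                                   ≡⟨ 𝔼-cong B (λ t → cong₂ miss
        -- The bounds hold for inputs given by vectors; an arbitrary `y` is only pointwise equal to
        -- `lookup (tabulate y)`, so `f` must be known to respect this.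
        (computed-extensional f ε≤ A computes (λ i → sym (lookup∘tabulate y i)))
        (eval-cong t (λ i → sym (lookup∘tabulate y i)))) ⟩
    𝔼 B (λ t → miss (F (tabulate y)) (eval t (lookup (tabulate y))))
      ≤⟨ amplified-err (proj₁ rounds) (tabulate y) ⟩
    e                                                                   ∎ where open ≤-Reasoning

  absurd-bound : LowerBoundRf f e r → ∀ {P : Set} → P
  absurd-bound lower = let (y , r≤) = lower B B-computes in contradiction (B-cost y) (≤⇒≯ r≤)

positive-factor : ∀ {c s r} → 0ℚ ≤ℚ c → 0ℚ ≤ℚ s → 0ℚ < c * (s * r) → 0ℚ < r
positive-factor {c} {s} {r} 0≤c 0≤s 0<csr = ≰⇒> λ r≤0 → ≤⇒≯ (begin
  c * (s * r)     ≤⟨ *-monoˡ 0≤c (*-monoˡ 0≤s r≤0) ⟩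
  c * (s * 0ℚ)    ≡⟨ solve 2 (λ c s → c :* (s :* con 0ℚ) := con 0ℚ) refl c s ⟩
  0ℚ              ∎) 0<csr
  where open ≤-Reasoning

open import Data.Integer using (+_)

theorem1p2 : Σ ℚ λ c → (0ℚ < c) ×
    ((n : ℕ) → 1 ≤ n → (f : BoolFun n) → (k : ℕ) → (k≥2 : 2 ≤ k) →
    (ε : ℚ) → 0ℚ ≤ℚ ε → ε ≤ℚ (+ 1 / 20) →
    (r : ℚ) → LowerBoundRf f (divBy ε k k≥2) r →
    LowerBoundRfk f k ε (c * (toℚ k * r)))
theorem1p2 = + 1 / 24 , positive⁻¹ (+ 1 / 24) , bound
  where
  bound : (n : ℕ) → 1 ≤ n → (f : BoolFun n) → (k : ℕ) → (k≥2 : 2 ≤ k) →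
    (ε : ℚ) → 0ℚ ≤ℚ ε → ε ≤ℚ (+ 1 / 20) →
    (r : ℚ) → LowerBoundRf f (divBy ε k k≥2) r →
    LowerBoundRfk f k ε (+ 1 / 24 * (toℚ k * r))
  bound n _ f (suc (suc m)) (ℕ.s≤s (ℕ.s≤s _)) ε 0≤ε ε≤ r lower A computes
    -- The lower bound has to exhibit an input, so the finitely many inputs are searched; if none is
    -- expensive, `A` is cheap on all of them.
    with any? (λ X → + 1 / 24 * (toℚ (suc (suc m)) * r) ≤? expQueries A (entries X))
           (vectors (vectors bools n) (suc (suc m)))
  ... | yes found = let (X , large) = satisfied found in entries X , large
  ... | no none = Assembly.absurd-bound f m 0≤ε ε≤ A computes 0<r (λ X → <⇒≤ (cheap X)) lower
    where
    cheap : ∀ X → expQueries A (entries X) < + 1 / 24 * (toℚ (suc (suc m)) * r)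
    cheap X = ≰⇒> λ large → none (lose (∈-vectors (∈-vectors ∈-bools) X) large)
    X₀ : Vec (Vec Bool n) (suc (suc m))
    X₀ = Vec.replicate _ (Vec.replicate n false)
    0<r : 0ℚ < r
    -- The cost of `A` on any one input is nonnegative and strictly below r k / 24, which forces r
    -- to be positive; the bound on the number of rounds needs this.
    0<r = positive-factor (nonNegative⁻¹ (+ 1 / 24)) (0≤toℚ (suc (suc m))) (≤-<-trans
      (≤-trans (0≤-𝔼 (proj₁ (proj₁ computes)) (λ t → 0≤toℚ (queries t (entries X₀))))
               (≤-reflexive (sym (expQueries≡𝔼 A (entries X₀)))))
      (cheap X₀))
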